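{- Let $T$ be a finite tree with $n$ vertices, rooted at a vertex $r$, whose vertices are $n$ agents sharing the cake $[0,1]$, each agent $i$ having an integrable non-negative density $v_i$ on $[0,1]$ and valuation $V_i(S)=\int_S v_i(x)\,dx$. Then the algorithm $\mathrm{AllocationTree}(T,r)$ (described in the context) outputs an allocation $(A_i)_{i}$ of the cake that is envy-free on $T$, i.e. $V_i(A_i)\ge V_i(A_j)$ for every agent $i$ and every neighbor $j$ of $i$ in $T$, and it uses $O(n^2)$ cuts.
   Context: **Cake cutting.** The cake is the interval $[0,1]$. There are $n$ agents; agent $i$ has an integrable non-negative density function $v_i$ on $[0,1]$. A piece is a finite union of disjoint intervals of $[0,1]$, and agent $i$ values a piece $S$ at $V_i(S)=\int_S v_i(x)\,dx$. An allocation is a partition of $[0,1]$ into $n$ disjoint pieces $(A_1,\dots,A_n)$, agent $i$ receiving $A_i$. A cut is a division of the cake at one point; the number of cuts of an algorithm is the total number of cuts made during its execution. The constant in $O(n^2)$ is absolute (independent of the tree and the valuations). **Envy-freeness on a graph.** For an undirected simple graph $G$ whose vertices are the agents, with $N(i)$ the set of neighbors of $i$, an allocation is envy-free on $G$ if $V_i(A_i)\ge V_i(A_j)$ for all $i$ and all $j\in N(i)$. **Austin procedure (available as a primitive).** For agents $i,j$, an integer $m>0$ and a piece $S$, $\mathrm{AustinCut}(i,j,m,S)$ outputs a partition of $S$ into $m$ pieces such that both agents value each of these pieces at exactly a $1/m$ fraction of their respective value of $S$; that is, $V_i(X)=V_i(S)/m$ and $V_j(X)=V_j(S)/m$ for each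 piece $X$ of the partition. It uses (at most) $2m$ cuts. **Notation.** $|T|$ is the number of vertices of $T$, and $T(i)$ is the subtree of $T$ rooted at vertex $i$ (consisting of $i$ and its descendants). **Algorithm $\mathrm{AlgTree}(T,r,(A_1,\dots,A_n))$**, where $T$ is a tree with root $r$, $n=|T|$, and $A_1,\dots,A_n$ are disjoint pieces of cake: 1. For each child $i$ of $r$ (one after another, in any order): among the pieces of $A_1,\dots,A_n$ not yet taken, agent $i$ picks $|T(i)|$ pieces that she values the highest (ties broken arbitrarily); let $S_i$ be the union of these pieces. 2. Allocate the one remaining piece to $r$. 3. For each child $i$ of $r$: apply $\mathrm{AustinCut}(i,r,|T(i)|,S_i)$ to divide $S_i$ into pieces $X_1,\dots,X_{|T(i)|}$, and run $\mathrm{AlgTree}(T(i),i,(X_1,\dots,X_{|T(i)|}))$. **Algorithm $\mathrm{AllocationTree}(T,r)$:** 1. Agent $r$ cuts the cake $[0,1]$ into $n=|T|$ pieces $A_1,\dots,A_n$ of equal value with respect to $V_r$. 2. Run $\mathrm{AlgTree}(T,r,(A_1,\dots,A_n))$. -}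

module Defs where

open import Algebra.Bundles using (CommutativeRing)
import Algebra.Definitions.RawMonoid as Multiples
import Algebra.Properties.Ring as RingProperties
open import Data.Bool using (Bool; true; false; not)
open import Data.Fin using (Fin)
open import Data.List using (List; []; _∷_; _++_; [_]; concat; length; map; foldr; sum; tabulate; allFin; applyUpTo)
open import Data.List.Relation.Binary.Permutation.Propositional using (_↭_)
open import Data.List.Relation.Unary.All using (All; [])
open import Data.List.Relation.Unary.AllPairs using (AllPairs; [])
open import Data.List.Relation.Unary.Any using (Any)
open import Data.Nat as ℕ using (ℕ; zero; suc)
open import Data.Product using (Σ-syntax; ∃; ∃-syntax; _×_; _,_; proj₁; proj₂)
open import Data.Sum using (inj₁; inj₂)
open import Function using (_∘_)
open import Level using (Lift; lift; lower; 0ℓ) renaming (suc to lsuc)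
open import Relation.Binary using (Rel; IsDecTotalOrder; _Respects_; _Preserves_⟶_)
import Relation.Binary.Construct.NonStrictToStrict as Strict
open import Relation.Binary.Construct.Closure.Symmetric using (SymClosure)
open import Relation.Binary.PropositionalEquality using (_≡_; _≢_)
open import Relation.Nullary using (¬_)
open import Relation.Unary using (Pred; U; ∁; _∩_; _⊆_; _⊥_; Satisfiable)

-- Complete ordered fields.  Up to isomorphism ℝ is the only one, so quantifying
-- over all of them is the classical axiomatic treatment of the real numbers.

module Bounds {c} {A : Set c} (_≤_ : Rel A 0ℓ) where

  UpperBound LowerBound : ∀ {ℓ} → Pred A ℓ → Pred A _
  UpperBound P u = ∀ x → P x → x ≤ u
  LowerBound P l = ∀ x → P x → l ≤ x

  IsSupremum IsInfimum : ∀ {ℓ} → Pred A ℓ → Pred A _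
  IsSupremum P s = UpperBound P s × LowerBound (UpperBound P) s
  IsInfimum  P s = LowerBound P s × UpperBound (LowerBound P) s

record Reals : Set (lsuc (lsuc 0ℓ)) where
  infix 4 _≤_ _<_
  field
    commutativeRing : CommutativeRing 0ℓ 0ℓ
  open CommutativeRing commutativeRing public
  open Multiples +-rawMonoid public using () renaming (_×_ to _·_)
  field
    _≤_             : Rel Carrier 0ℓ
    isDecTotalOrder : IsDecTotalOrder _≈_ _≤_
  open Bounds _≤_ public
  field
    0≉1        : ¬ 0# ≈ 1#
    inverse    : ∀ x → ¬ x ≈ 0# → ∃[ y ] x * y ≈ 1#
    +-monoʳ-≤  : ∀ z {x y} → x ≤ y → z + x ≤ z + y
    *-nonNeg   : ∀ {x y} → 0# ≤ x → 0# ≤ y → 0# ≤ x * y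
    supremum   : (P : Pred Carrier (lsuc 0ℓ)) →
                 Satisfiable P → Satisfiable (UpperBound P) → ∃ (IsSupremum P)

  _<_ : Rel Carrier 0ℓ
  _<_ = Strict._<_ _≈_ _≤_

  module ≤ = IsDecTotalOrder isDecTotalOrder

  Σℝ : List Carrier → Carrier
  Σℝ = foldr _+_ 0#

  infimum : (P : Pred Carrier 0ℓ) →
            Satisfiable P → Satisfiable (LowerBound P) → ∃ (IsInfimum P)
  infimum P (x , Px) (l , l≤P) = s , (λ y Py → least y λ z z≤P → lower z≤P y Py)
                                   , (λ z z≤P → upper z (lift z≤P))
    where
    S = supremum (λ z → Lift (lsuc 0ℓ) (LowerBound P z))
                 (l , lift l≤P) (x , λ z z≤P → lower z≤P x Px)
    s = proj₁ S
    upper = proj₁ (proj₂ S)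
    least = proj₂ (proj₂ S)

  0≤1 : 0# ≤ 1#
  0≤1 with ≤.total 0# 1#
  ... | inj₁ 0≤1 = 0≤1
  ... | inj₂ 1≤0 = ≤.≤-respʳ-≈ -1*-1≈1 (*-nonNeg 0≤-1 0≤-1)
    where
    open RingProperties ring
    0≤-1 : 0# ≤ - 1#
    0≤-1 = ≤.≤-respˡ-≈ (-‿inverseˡ 1#) (≤.≤-respʳ-≈ (+-identityʳ (- 1#)) (+-monoʳ-≤ (- 1#) 1≤0))
    -1*-1≈1 : - 1# * - 1# ≈ 1#
    -1*-1≈1 = trans (-1*x≈-x (- 1#)) (-‿involutive 1#)

-- A vertex is its path from the root, so distinct positions are distinct agents.

data Tree : Set where
  node : ∀ {d} → (Fin d → Tree) → Tree

size : Tree → ℕ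
size (node ts) = suc (sum (tabulate (λ c → size (ts c))))

data Vertex : Tree → Set where
  root  : ∀ {T} → Vertex T
  below : ∀ {d} {ts : Fin d → Tree} (c : Fin d) → Vertex (ts c) → Vertex (node ts)

data _ParentOf_ : ∀ {T} → Rel (Vertex T) 0ℓ where
  top   : ∀ {d} {ts : Fin d → Tree} (c : Fin d) →
          _ParentOf_ {node ts} root (below c root)
  below : ∀ {d} {ts : Fin d → Tree} (c : Fin d) {i j : Vertex (ts c)} →
          i ParentOf j → _ParentOf_ {node ts} (below c i) (below c j)

Neighbour : ∀ {T} → Rel (Vertex T) 0ℓ
Neighbour = SymClosure _ParentOf_

module CakeCutting (ℝ : Reals) where

  open Reals ℝ

  record Cake : Set where
    constructor point
    field
      pos   : Carrier
      0≤pos : 0# ≤ pos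
      pos≤1 : pos ≤ 1#
  open Cake public

  infix 4 _≈ᶜ_
  _≈ᶜ_ : Rel Cake 0ℓ
  x ≈ᶜ y = pos x ≈ pos y

  edge : Bool → Rel Carrier 0ℓ
  edge true  = _≤_
  edge false = _<_

  edge⇒≤ : ∀ b {x y} → edge b x y → x ≤ y
  edge⇒≤ true  x≤y = x≤y
  edge⇒≤ false x<y = proj₁ x<y

  record Interval : Set where
    constructor interval
    field
      lo hi       : Cake
      lo≤hi       : pos lo ≤ pos hi
      loIn? hiIn? : Bool
  open Interval public

  infix 4 _∈ᴵ_
  _∈ᴵ_ : Cake → Interval → Set
  x ∈ᴵ I = edge (loIn? I) (pos (lo I)) (pos x) × edge (hiIn? I) (pos x) (pos (hi I))

  width : Interval → Carrier
  width I = pos (hi I) - pos (lo I)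

  wholeCake : Interval
  wholeCake = interval (point 0# ≤.refl 0≤1) (point 1# 0≤1 ≤.refl) 0≤1 true true

  -- Lebesgue outer measure and Carathéodory measurability on the cake.  A cover
  -- is related to all upper bounds of its total width rather than to the
  -- total itself; the infimum is the same.

  CoveredWithin : Pred Cake 0ℓ → Pred Carrier 0ℓ
  CoveredWithin E s =
    Σ[ I ∈ (ℕ → Interval) ]
      (∀ x → E x → ∃[ k ] x ∈ᴵ I k) ×
      (∀ n → Σℝ (applyUpTo (width ∘ I) n) ≤ s)

  coveredWithin-1 : ∀ E → CoveredWithin E 1#
  coveredWithin-1 E = I , (λ x _ → 0 , 0≤pos x , pos≤1 x) , bound
    where
    I : ℕ → Interval
    I zero    = wholeCake
    I (suc _) = interval (lo wholeCake) (lo wholeCake) ≤.refl true true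
    zeros : ∀ n → Σℝ (applyUpTo (width ∘ I ∘ suc) n) ≈ 0#
    zeros zero    = refl
    zeros (suc n) = trans (+-cong (-‿inverseʳ 0#) (zeros n)) (+-identityˡ 0#)
    1-0 : 1# - 0# ≈ 1#
    1-0 = trans (+-congˡ (RingProperties.-0#≈0# ring)) (+-identityʳ 1#)
    bound : ∀ n → Σℝ (applyUpTo (width ∘ I) n) ≤ 1#
    bound zero    = 0≤1
    bound (suc n) = ≤.reflexive (trans (+-cong 1-0 (zeros n)) (+-identityʳ 1#))

  outerMeasure : Pred Cake 0ℓ → Carrier
  outerMeasure E = proj₁ (infimum (CoveredWithin E)
    (1# , coveredWithin-1 E) (0# , λ s (_ , _ , sums≤s) → sums≤s 0))

  Measurable : Pred Cake 0ℓ → Set (lsuc 0ℓ)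
  Measurable E =
    E Respects _≈ᶜ_ ×
    (∀ (A : Pred Cake 0ℓ) →
       outerMeasure A ≈ outerMeasure (A ∩ E) + outerMeasure (A ∩ ∁ E))

  -- The Lebesgue integral of a non-negative measurable function over S: the
  -- supremum of the integrals of non-negative simple functions that vanish
  -- off S and lie below f.

  record Step (f : Cake → Carrier) : Set (lsuc 0ℓ) where
    field
      region     : Pred Cake 0ℓ
      measurable : Measurable region
      height     : Carrier
      0≤height   : 0# ≤ height
      height≤f   : ∀ x → region x → height ≤ f x
  open Step public using (region; height)

  LowerSum : (Cake → Carrier) → Pred Cake 0ℓ → Pred Carrier (lsuc 0ℓ)
  LowerSum f S y =
    Σ[ φ ∈ List (Step f) ]
      AllPairs (λ s t → region s ⊥ region t) φ ×
      All (λ s → region s ⊆ S) φ ×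
      y ≈ Σℝ (map (λ s → height s * outerMeasure (region s)) φ)

  record Density : Set (lsuc 0ℓ) where
    field
      value      : Cake → Carrier
      cong       : value Preserves _≈ᶜ_ ⟶ _≈_
      nonNeg     : ∀ x → 0# ≤ value x
      measurable : ∀ c → Measurable (λ x → c < value x)
      integrable : Satisfiable (UpperBound (LowerSum value U))
  open Density public using (value)

  ∫[_]_ : Pred Cake 0ℓ → Density → Carrier
  ∫[ S ] v = proj₁ (supremum (LowerSum (value v) S)
    (0# , [] , [] , [] , refl)
    (let u , sums≤u = Density.integrable v in
     u , λ { y (φ , disjoint , _ , y≈) → sums≤u y (φ , disjoint , everywhere φ , y≈) }))
    where
    everywhere : (φ : List (Step (value v))) → All (λ s → region s ⊆ U) φ
    everywhere []      = []
    everywhere (s ∷ φ) = All._∷_ _ (everywhere φ)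

  -- A region lists the intervals into which the cuts have so far divided it.

  Region : Set
  Region = List Interval

  ⟦_⟧ : Region → Pred Cake 0ℓ
  ⟦ S ⟧ x = Any (x ∈ᴵ_) S

  IsPiece : Pred Region 0ℓ
  IsPiece = AllPairs (λ I J → (_∈ᴵ I) ⊥ (_∈ᴵ J))

  V : Density → Region → Carrier
  V v S = ∫[ ⟦ S ⟧ ] v

  -- One cut, at a point p of an interval; the flag says whether p itself goes
  -- to the left part.

  left right : ∀ I p → p ∈ᴵ I → Bool → Interval
  left  I p (lo≤p , _) b = interval (lo I) p (edge⇒≤ (loIn? I) lo≤p) (loIn? I) b
  right I p (_ , p≤hi) b = interval p (hi I) (edge⇒≤ (hiIn? I) p≤hi) (not b) (hiIn? I)

  data Cut : Rel Region 0ℓ where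
    here  : ∀ {I S} p (p∈I : p ∈ᴵ I) b →
            Cut (I ∷ S) (left I p p∈I b ∷ right I p p∈I b ∷ S)
    there : ∀ {I S S′} → Cut S S′ → Cut (I ∷ S) (I ∷ S′)

  data Cuts : ℕ → Rel Region 0ℓ where
    []  : ∀ {S} → Cuts 0 S S
    _∷_ : ∀ {k S S′ S″} → Cut S S′ → Cuts k S′ S″ → Cuts (suc k) S S″

  Division : ℕ → Region → List Region → Set
  Division k S Xs = ∃[ S′ ] Cuts k S S′ × S′ ↭ concat Xs

  record AustinCut (v w : Density) (m : ℕ) (S : Region) (Xs : List Region) (k : ℕ) : Set where
    field
      number   : length Xs ≡ m
      cuts     : k ℕ.≤ 2 ℕ.* m
      division : Division k S Xs
      exact-v  : All (λ X → m · V v X ≈ V v S) Xs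
      exact-w  : All (λ X → m · V w X ≈ V w S) Xs

  AustinAvailable : ∀ {Agent : Set} → (Agent → Density) → Set
  AustinAvailable v =
    ∀ i j m S → 0 ℕ.< m → IsPiece S → ∃[ Xs ] ∃[ k ] AustinCut (v i) (v j) m S Xs k

  -- Choosing v ts chosen last order Ps: the children of the root pick from Ps
  -- in the given order, child c taking chosen c, and last is what remains.

  data Choosing {d} {ts : Fin d → Tree} (v : Vertex (node ts) → Density)
                (chosen : Fin d → List Region) (last : Region) :
                List (Fin d) → List Region → Set where
    done : Choosing v chosen last [] [ last ]
    pick : ∀ {c order Ps rest} →
           length (chosen c) ≡ size (ts c) →
           Ps ↭ chosen c ++ rest →
           All (λ P → All (λ Q → V (v (below c root)) Q ≤ V (v (below c root)) P) rest) (chosen c) →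
           Choosing v chosen last order rest →
           Choosing v chosen last (c ∷ order) Ps

  -- AlgTree T v Ps A k: the algorithm, run on the tree T and the pieces Ps, may
  -- give each vertex i the piece A i and make k cuts.

  data AlgTree : (T : Tree) → (Vertex T → Density) → List Region →
                 (Vertex T → Region) → ℕ → Set (lsuc 0ℓ) where
    run : ∀ {d} {ts : Fin d → Tree} {v : Vertex (node ts) → Density} {Ps}
            {A : Vertex (node ts) → Region}
          (order : List (Fin d)) → order ↭ allFin d →
          (chosen : Fin d → List Region) →
          Choosing v chosen (A root) order Ps →
          (Xs : Fin d → List Region) (k l : Fin d → ℕ) →
          (∀ c → AustinCut (v (below c root)) (v root) (size (ts c)) (concat (chosen c)) (Xs c) (k c)) →
          (∀ c → AlgTree (ts c) (v ∘ below c) (Xs c) (A ∘ below c) (l c)) →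
          AlgTree (node ts) v Ps A (sum (tabulate (λ c → k c ℕ.+ l c)))

  -- Dividing the cake into n pieces takes n - 1 cuts.

  data AllocationTree (T : Tree) (v : Vertex T → Density) :
                      (Vertex T → Region) → ℕ → Set (lsuc 0ℓ) where
    run : ∀ {Ps A k l} →
          length Ps ≡ size T →
          suc k ≡ size T →
          Division k [ wholeCake ] Ps →
          AllPairs (λ P Q → V (v root) P ≈ V (v root) Q) Ps →
          AlgTree T v Ps A l →
          AllocationTree T v A (k ℕ.+ l)

  record IsAllocation {Agent : Set} (A : Agent → Region) : Set where
    field
      piece    : ∀ i → IsPiece (A i)
      disjoint : ∀ {i j} → i ≢ j → ⟦ A i ⟧ ⊥ ⟦ A j ⟧
      covers   : ∀ x → ∃[ i ] ⟦ A i ⟧ x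

  EnvyFree : ∀ {Agent : Set} → Rel Agent 0ℓ → (Agent → Density) → (Agent → Region) → Set
  EnvyFree _∼_ v A = ∀ {i j} → i ∼ j → V (v i) (A j) ≤ V (v i) (A i)

-- Envy-freeness: every valuation is additive on disjoint intervals, because intervals
-- are Carathéodory measurable.  Hence the root, indifferent between the pieces it is
-- handed, values S_c at |T(c)| times its own share and so, Austin's cut being exact, is
-- indifferent between its share and child c's; and c, having picked its |T(c)| best
-- pieces, values each part of S_c at their average, which is at least the value of the
-- piece left for the root.  Austin's cut also makes c indifferent between the parts of
-- S_c, so the argument recurs into T(c).
--
-- Cuts: a child whose subtree has s vertices costs 2s cuts and then, inductively, at most s²;
-- the sum of 2s + s² over the children is below n² when the s add up to n - 1.
--
-- Existence of a run rests on the root's initial division: V [0, x) is continuous in x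
-- because the integral is approximated from below by simple functions, so the
-- intermediate value theorem gives n - 1 cut points.  The order on the reals is
-- decidable, so inequalities are stable under double negation and may be proved by
-- contradiction.

module Submission where

open import Defs
import Algebra.Properties.CommutativeSemigroup
import Algebra.Properties.Ring
import Algebra.Properties.Semiring.Mult
import Algebra.Solver.Ring.NaturalCoefficients.Default
open import Data.Bool using (true; false; not)
open import Data.Fin using (Fin; zero; suc)
import Data.Fin.Properties as Fin
open import Data.List
  using (List; []; _∷_; [_]; _++_; map; length; concat; applyUpTo; take; drop; tabulate; allFin)
open import Data.List.Membership.Propositional using (_∈_)
open import Data.List.Membership.Propositional.Properties using (∈-allFin)
open import Data.List.Properties
  using (length-map; length-++; length-take; take++drop≡id; concat-++; concat-map-[_])
open import Data.List.Relation.Binary.Permutation.Propositional as ↭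
  using (_↭_; ↭-refl; ↭-sym; ↭-trans; ↭-reflexive; ↭⇒↭ₛ)
open import Data.List.Relation.Binary.Permutation.Propositional.Properties
  using (Any-resp-↭; ↭-length; ++⁺ˡ; shifts)
open import Data.List.Relation.Binary.Permutation.Setoid.Properties using (AllPairs-resp-↭)
open import Data.List.Relation.Unary.All as All using (All; []; _∷_)
import Data.List.Relation.Unary.All.Properties as All
open import Data.List.Relation.Unary.AllPairs as AllPairs using (AllPairs; []; _∷_)
import Data.List.Relation.Unary.AllPairs.Properties as AllPairs
open import Data.List.Relation.Unary.Any using (Any; here; there)
import Data.List.Relation.Unary.Any.Properties as Any
open import Data.List.Relation.Unary.Linked.Properties using (Linked⇒AllPairs)
import Data.List.Sort
open import Data.Nat as ℕ using (ℕ; zero; suc; z≤n; s≤s)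
open import Data.Nat.ListAction using (sum)
import Data.Nat.Properties as ℕ
open import Data.Nat.Solver using (module +-*-Solver)
open import Data.Product using (Σ-syntax; ∃; ∃-syntax; _×_; _,_; proj₁; proj₂)
open import Data.Sum using (_⊎_; inj₁; inj₂; [_,_]′)
open import Function using (_∘_; id)
open import Level using (Lift; lift; 0ℓ) renaming (suc to lsuc)
open import Relation.Binary using (DecTotalOrder; Rel; _Respects_)
open import Relation.Binary.Construct.Closure.Symmetric using (fwd; bwd)
import Relation.Binary.Construct.On as On
import Relation.Binary.Properties.DecTotalOrder
open import Relation.Binary.PropositionalEquality as ≡ using (_≡_; _≢_)
import Relation.Binary.Reasoning.PartialOrder
open import Relation.Nullary using (¬_; yes; no; contradiction; ¬?)
open import Relation.Nullary.Decidable using (decidable-stable; _×-dec_)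
open import Relation.Unary using (Pred; Decidable; ∁; _∩_; _⊆_; _⊥_)

module Nat = +-*-Solver

AllPairs-++⁻ : ∀ {a ℓ} {A : Set a} {R : Rel A ℓ} xs {ys} → AllPairs R (xs ++ ys) →
               AllPairs R xs × AllPairs R ys × All (λ x → All (R x) ys) xs
AllPairs-++⁻ []       pys         = [] , pys , []
AllPairs-++⁻ (x ∷ xs) (px ∷ pxys) =
  let pxs , pys , pxsys = AllPairs-++⁻ xs pxys
  in All.++⁻ˡ xs px ∷ pxs , pys , All.++⁻ʳ xs px ∷ pxsys

-- Arithmetic and suprema in a complete ordered field

module OrderedField (ℝ : Reals) where

  open Reals ℝ
  open Algebra.Properties.Ring ring using (\\-leftDividesʳ; //-rightDividesˡ)
  open Algebra.Properties.Semiring.Mult semiring using (×-assoc-*; ×-congʳ)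

  decTotalOrder : DecTotalOrder 0ℓ 0ℓ 0ℓ
  decTotalOrder = record { isDecTotalOrder = isDecTotalOrder }

  open DecTotalOrder decTotalOrder public using (_≤?_; poset)
  open Relation.Binary.Properties.DecTotalOrder decTotalOrder public
    using (≰⇒>; ≰⇒≥; <⇒≱; <-respʳ-≈; <-respˡ-≈; ≥-decTotalOrder)
  open Algebra.Solver.Ring.NaturalCoefficients.Default commutativeSemiring public
    using (solve; _:+_; _:*_; _:=_)
  module ≤-Reasoning = Relation.Binary.Reasoning.PartialOrder poset

  +-monoˡ-≤ : ∀ z {x y} → x ≤ y → x + z ≤ y + z
  +-monoˡ-≤ z {x} {y} x≤y =
    ≤.≤-respˡ-≈ (+-comm z x) (≤.≤-respʳ-≈ (+-comm z y) (+-monoʳ-≤ z x≤y))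

  +-mono-≤ : ∀ {x y u v} → x ≤ y → u ≤ v → x + u ≤ y + v
  +-mono-≤ {y = y} {u = u} x≤y u≤v = ≤.trans (+-monoˡ-≤ u x≤y) (+-monoʳ-≤ y u≤v)

  +-cancelˡ-≤ : ∀ z {x y} → z + x ≤ z + y → x ≤ y
  +-cancelˡ-≤ z {x} {y} z+x≤z+y =
    ≤.≤-respˡ-≈ (\\-leftDividesʳ z x) (≤.≤-respʳ-≈ (\\-leftDividesʳ z y)
      (+-monoʳ-≤ (- z) z+x≤z+y))

  +-cancelʳ-≤ : ∀ z {x y} → x + z ≤ y + z → x ≤ y
  +-cancelʳ-≤ z {x} {y} x+z≤y+z =
    +-cancelˡ-≤ z (≤.≤-respˡ-≈ (+-comm x z) (≤.≤-respʳ-≈ (+-comm y z) x+z≤y+z))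

  x-y+y≈x : ∀ x y → x - y + y ≈ x
  x-y+y≈x x y = //-rightDividesˡ y x

  x≤y+z⇒x-z≤y : ∀ {x y z} → x ≤ y + z → x - z ≤ y
  x≤y+z⇒x-z≤y {x} {y} {z} x≤y+z =
    +-cancelʳ-≤ z (≤.≤-respˡ-≈ (sym (x-y+y≈x x z)) x≤y+z)

  x+z≤y⇒x≤y-z : ∀ {x y z} → x + z ≤ y → x ≤ y - z
  x+z≤y⇒x≤y-z {x} {y} {z} x+z≤y =
    +-cancelʳ-≤ z (≤.≤-respʳ-≈ (sym (x-y+y≈x y z)) x+z≤y)

  x≤y⇒0≤y-x : ∀ {x y} → x ≤ y → 0# ≤ y - x
  x≤y⇒0≤y-x {x} {y} x≤y = x+z≤y⇒x≤y-z (≤.≤-respˡ-≈ (sym (+-identityˡ x)) x≤y)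

  x<y⇒0<y-x : ∀ {x y} → x < y → 0# < y - x
  x<y⇒0<y-x {x} {y} x<y = ≰⇒> λ y-x≤0 → <⇒≱ x<y
    (≤.≤-respˡ-≈ (x-y+y≈x y x) (≤.≤-respʳ-≈ (+-identityˡ x) (+-monoˡ-≤ x y-x≤0)))

  x≤y+x : ∀ {x y} → 0# ≤ y → x ≤ y + x
  x≤y+x {x} 0≤y = ≤.≤-respˡ-≈ (+-identityˡ x) (+-monoˡ-≤ x 0≤y)

  x≤x+y : ∀ {x y} → 0# ≤ y → x ≤ x + y
  x≤x+y {x} 0≤y = ≤.≤-respˡ-≈ (+-identityʳ x) (+-monoʳ-≤ x 0≤y)

  +-nonNeg : ∀ {x y} → 0# ≤ x → 0# ≤ y → 0# ≤ x + y
  +-nonNeg 0≤x 0≤y = ≤.trans 0≤y (x≤y+x 0≤x)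

  x+δ≰x : ∀ {x δ} → 0# < δ → ¬ x + δ ≤ x
  x+δ≰x {x} 0<δ x+δ≤x =
    <⇒≱ 0<δ (+-cancelˡ-≤ x (≤.≤-respʳ-≈ (sym (+-identityʳ x)) x+δ≤x))

  *-monoʳ-≤ : ∀ {z x y} → 0# ≤ z → x ≤ y → z * x ≤ z * y
  *-monoʳ-≤ {z} {x} {y} 0≤z x≤y = ≤.≤-respʳ-≈
    (trans (sym (distribˡ z (y - x) x)) (*-congˡ (x-y+y≈x y x)))
    (x≤y+x (*-nonNeg 0≤z (x≤y⇒0≤y-x x≤y)))

  quotient : ∀ {k} → 0# < k → ∀ {x} → 0# ≤ x → ∃[ q ] 0# ≤ q × k * q ≈ x
  quotient {k} 0<k {x} 0≤x with inverse k (λ k≈0 → proj₂ 0<k (sym k≈0))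
  ... | k⁻¹ , k*k⁻¹≈1 = k⁻¹ * x , *-nonNeg 0≤k⁻¹ 0≤x
                      , trans (sym (*-assoc k k⁻¹ x)) (trans (*-congʳ k*k⁻¹≈1) (*-identityˡ x))
    where
    0≤k⁻¹ : 0# ≤ k⁻¹
    -- If `k⁻¹` were negative, then `k * k⁻¹` would be at most 0 while being equal to 1.
    0≤k⁻¹ = decidable-stable (0# ≤? k⁻¹) λ 0≰k⁻¹ →
      let k*k⁻¹≤0 = ≤.≤-respʳ-≈ (zeroʳ k) (*-monoʳ-≤ (proj₁ 0<k) (≰⇒≥ 0≰k⁻¹))
      in 0≉1 (≤.antisym 0≤1 (≤.≤-respˡ-≈ k*k⁻¹≈1 k*k⁻¹≤0))

  quotient-pos : ∀ {k} → 0# < k → ∀ {x} → 0# < x → ∃[ q ] 0# < q × k * q ≈ x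
  quotient-pos {k} 0<k (0≤x , 0≉x) with quotient 0<k 0≤x
  ... | q , 0≤q , kq≈x =
    q , (0≤q , λ 0≈q → 0≉x (trans (sym (zeroʳ k)) (trans (*-congˡ 0≈q) kq≈x))) , kq≈x

  0<1 : 0# < 1#
  0<1 = 0≤1 , 0≉1

  0<x+1 : ∀ {x} → 0# ≤ x → 0# < x + 1#
  0<x+1 {x} 0≤x = ≰⇒> λ x+1≤0 → <⇒≱ 0<1 (≤.trans (x≤y+x 0≤x) x+1≤0)

  ·-nonNeg : ∀ n {x} → 0# ≤ x → 0# ≤ n · x
  ·-nonNeg zero    0≤x = ≤.refl
  ·-nonNeg (suc n) 0≤x = +-nonNeg 0≤x (·-nonNeg n 0≤x)

  ·-mono-≤ : ∀ n {x y} → x ≤ y → n · x ≤ n · y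
  ·-mono-≤ zero    x≤y = ≤.refl
  ·-mono-≤ (suc n) x≤y = +-mono-≤ x≤y (·-mono-≤ n x≤y)

  ·-cancel-≤ : ∀ {n} → 0 ℕ.< n → ∀ {x y} → n · x ≤ n · y → x ≤ y
  ·-cancel-≤ {suc n} _ {x} {y} nx≤ny with ≤.total x y
  ... | inj₁ x≤y = x≤y
  ... | inj₂ y≤x = +-cancelʳ-≤ (n · x) (≤.trans nx≤ny (+-monoʳ-≤ y (·-mono-≤ n y≤x)))

  ·-quotient : ∀ n {x} → 0# ≤ x → ∃[ q ] 0# ≤ q × suc n · q ≈ x
  ·-quotient n 0≤x with quotient (<-respʳ-≈ (+-comm _ 1#) (0<x+1 (·-nonNeg n 0≤1))) 0≤x
  ... | q , 0≤q , nq≈x =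
    q , 0≤q , trans (×-congʳ (suc n) (sym (*-identityˡ q))) (trans (sym (×-assoc-* (suc n) 1# q)) nq≈x)

  -- Moving `z` to the other side makes `y - z` an upper bound of `P`. Applied to one summand after
  -- the other, this bounds a sum of two suprema without choosing approximants.
  sup-+-≤ : ∀ {ℓ} {P : Pred Carrier ℓ} {s y z} →
            IsSupremum P s → (∀ x → P x → x + z ≤ y) → s + z ≤ y
  sup-+-≤ {y = y} {z} (_ , least) Px⇒x+z≤y =
    ≤.≤-respʳ-≈ (x-y+y≈x y z) (+-monoˡ-≤ z (least _ λ x Px → x+z≤y⇒x≤y-z (Px⇒x+z≤y x Px)))

  inf-+-≥ : ∀ {ℓ} {P : Pred Carrier ℓ} {i y z} →
            IsInfimum P i → (∀ x → P x → y ≤ x + z) → y ≤ i + z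
  inf-+-≥ {y = y} {z} (_ , greatest) Px⇒y≤x+z =
    ≤.≤-respˡ-≈ (x-y+y≈x y z) (+-monoˡ-≤ z (greatest _ λ x Px → x≤y+z⇒x-z≤y (Px⇒y≤x+z x Px)))

  -- Otherwise `s - ε` would already bound `P`. The witness is obtained only under a double
  -- negation, which suffices for deriving contradictions and hence stable inequalities.
  sup-approx : ∀ {ℓ} {P : Pred Carrier ℓ} {s ε} → IsSupremum P s → 0# < ε →
               ¬ ¬ (∃[ y ] P y × s < y + ε)
  sup-approx {s = s} {ε} isSup 0<ε none =
    x+δ≰x 0<ε (sup-+-≤ isSup λ y Py →
      decidable-stable (y + ε ≤? s) λ y+ε≰s → none (y , Py , ≰⇒> y+ε≰s))

-- Lebesgue outer measure and the measurability of intervals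

module Measure (ℝ : Reals) where

  open Reals ℝ
  open OrderedField ℝ
  open CakeCutting ℝ
  open Algebra.Properties.CommutativeSemigroup +-commutativeSemigroup using (interchange)

  total : (ℕ → Interval) → ℕ → Carrier
  total I n = Σℝ (applyUpTo (width ∘ I) n)

  0≤width : ∀ I → 0# ≤ width I
  0≤width I = x≤y⇒0≤y-x (lo≤hi I)

  total-mono : ∀ I {m n} → m ℕ.≤ n → total I m ≤ total I n
  total-mono I {n = zero}  z≤n       = ≤.refl
  total-mono I {n = suc n} z≤n       =
    +-nonNeg (0≤width (I 0)) (total-mono (I ∘ suc) {n = n} z≤n)
  total-mono I             (s≤s m≤n) = +-monoʳ-≤ _ (total-mono (I ∘ suc) m≤n)

  total-+ : ∀ (I J K : ℕ → Interval) → (∀ k → width (J k) + width (K k) ≈ width (I k)) →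
            ∀ n → total J n + total K n ≈ total I n
  total-+ I J K eq zero    = +-identityʳ 0#
  total-+ I J K eq (suc n) =
    trans (interchange _ _ _ _) (+-cong (eq 0) (total-+ (I ∘ suc) (J ∘ suc) (K ∘ suc) (eq ∘ suc) n))

  closed : (a b : Cake) → pos a ≤ pos b → Interval
  closed a b a≤b = interval a b a≤b true true

  single : Cake → Interval
  single a = closed a a ≤.refl

  width-single : ∀ a → width (single a) ≈ 0#
  width-single a = -‿inverseʳ (pos a)

  om-isInf : ∀ E → IsInfimum (CoveredWithin E) (outerMeasure E)
  om-isInf E = proj₂ (infimum (CoveredWithin E) _ _)

  om-lower : ∀ {E s} → CoveredWithin E s → outerMeasure E ≤ s
  om-lower {E} {s} = proj₁ (om-isInf E) s

  om-mono : ∀ {E F} → E ⊆ F → outerMeasure E ≤ outerMeasure F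
  om-mono {E} {F} E⊆F = proj₂ (om-isInf F) _ λ s (I , covers , sums≤s) →
    om-lower {E} (I , (λ x Ex → covers x (E⊆F Ex)) , sums≤s)

  om-cong : ∀ {E F} → E ⊆ F → F ⊆ E → outerMeasure E ≈ outerMeasure F
  om-cong {E} {F} E⊆F F⊆E = ≤.antisym (om-mono {E} {F} E⊆F) (om-mono {F} {E} F⊆E)

  om-interval : ∀ {E} J → E ⊆ (_∈ᴵ J) → outerMeasure E ≤ width J
  om-interval {E} J E⊆J = om-lower {E} (I , (λ x Ex → 0 , E⊆J Ex) , sums≤)
    where
    I : ℕ → Interval
    I zero    = J
    -- A cover is an infinite sequence, so it is padded with single points, whose width is 0.
    I (suc _) = single (lo J)
    zeros : ∀ n → total (I ∘ suc) n ≈ 0#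
    zeros zero    = refl
    zeros (suc n) = trans (+-cong (width-single (lo J)) (zeros n)) (+-identityˡ 0#)
    sums≤ : ∀ n → total I n ≤ width J
    sums≤ zero    = 0≤width J
    sums≤ (suc n) = ≤.reflexive (trans (+-congˡ (zeros n)) (+-identityʳ _))

  interleave : {A : Set} → (ℕ → A) → (ℕ → A) → ℕ → A
  interleave f g zero    = f 0
  interleave f g (suc n) = interleave g (f ∘ suc) n

  interleave-ˡ : ∀ {A : Set} (P : Pred A 0ℓ) f g k → P (f k) → ∃[ j ] P (interleave f g j)
  interleave-ˡ P f g zero    p = 0 , p
  interleave-ˡ P f g (suc k) p with interleave-ˡ P (f ∘ suc) (g ∘ suc) k p
  ... | j , q = suc (suc j) , q

  interleave-ʳ : ∀ {A : Set} (P : Pred A 0ℓ) f g k → P (g k) → ∃[ j ] P (interleave f g j)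
  interleave-ʳ P f g k p with interleave-ˡ P g (f ∘ suc) k p
  ... | j , q = suc j , q

  -- The induction pays for the first interval of `I` out of `s`. The roles then change: `J` comes
  -- first, and the tail of `I` has the bound `s - width (I 0)`.
  total-interleave : ∀ I J {s t} → (∀ n → total I n ≤ s) → (∀ n → total J n ≤ t) →
                     ∀ n → total (interleave I J) n ≤ s + t
  total-interleave I J I≤s J≤t zero    = +-nonNeg (I≤s 0) (J≤t 0)
  total-interleave I J {s} {t} I≤s J≤t (suc n) = begin
    width (I 0) + total (interleave J (I ∘ suc)) n
      ≤⟨ +-monoʳ-≤ _ (total-interleave J (I ∘ suc) J≤t tail≤ n) ⟩
    width (I 0) + (t + (s - width (I 0)))
      ≈⟨ solve 3 (λ w t u → w :+ (t :+ u) := (u :+ w) :+ t) refl _ _ _ ⟩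
    s - width (I 0) + width (I 0) + t
      ≈⟨ +-congʳ (x-y+y≈x s _) ⟩
    s + t ∎
    where
    open ≤-Reasoning
    tail≤ : ∀ m → total (I ∘ suc) m ≤ s - width (I 0)
    tail≤ m = x+z≤y⇒x≤y-z (≤.≤-respˡ-≈ (+-comm _ _) (I≤s (suc m)))

  om-∪ : ∀ {A E F} → (∀ x → A x → E x ⊎ F x) → outerMeasure A ≤ outerMeasure E + outerMeasure F
  om-∪ {A} {E} {F} A⊆E∪F =
    inf-+-≥ (om-isInf E) λ s coverE → ≤.≤-respʳ-≈ (+-comm _ _)
      (inf-+-≥ (om-isInf F) λ t coverF → ≤.≤-respʳ-≈ (+-comm _ _)
        (om-lower {A} (both coverE coverF)))
    where
    both : ∀ {s t} → CoveredWithin E s → CoveredWithin F t → CoveredWithin A (s + t)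
    both (I , I-covers , I≤s) (J , J-covers , J≤t) =
      interleave I J , covers , total-interleave I J I≤s J≤t
      where
      covers : ∀ x → A x → ∃[ k ] x ∈ᴵ interleave I J k
      covers x Ax with A⊆E∪F x Ax
      ... | inj₁ Ex = let k , x∈I = I-covers x Ex in interleave-ˡ (x ∈ᴵ_) I J k x∈I
      ... | inj₂ Fx = let k , x∈J = J-covers x Fx in interleave-ʳ (x ∈ᴵ_) I J k x∈J

  -- A criterion for measurability tested on single intervals. `L` and `R` need only contain the two
  -- parts of `I`; they may share points, so closed intervals and single points will do.
  Splits : Pred (Pred Cake 0ℓ) 0ℓ
  Splits E = ∀ I → Σ[ L ∈ Interval ] Σ[ R ∈ Interval ]
    width L + width R ≈ width I ×
    (∀ x → x ∈ᴵ I → E x → x ∈ᴵ L) × (∀ x → x ∈ᴵ I → ¬ E x → x ∈ᴵ R)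

  -- One inequality is subadditivity, where deciding `E` sorts the points of `A`. For the other,
  -- splitting each interval of a cover of `A` yields covers of `A ∩ E` and `A ∩ ∁ E` of the same
  -- combined width.
  splits⇒measurable : ∀ {E} → Decidable E → E Respects _≈ᶜ_ → Splits E → Measurable E
  splits⇒measurable {E} E? resp split = resp , λ A → ≤.antisym
    (om-∪ {A} {A ∩ E} {A ∩ ∁ E} (decide A))
    (proj₂ (om-isInf A) _ λ s (I , covers , I≤s) → superadditive A s I covers I≤s)
    where
    decide : ∀ A x → A x → (A ∩ E) x ⊎ (A ∩ ∁ E) x
    decide A x Ax with E? x
    ... | yes Ex = inj₁ (Ax , Ex)
    ... | no ¬Ex = inj₂ (Ax , ¬Ex)
    superadditive : ∀ A s (I : ℕ → Interval) → (∀ x → A x → ∃[ k ] x ∈ᴵ I k) →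
                    (∀ n → total I n ≤ s) → outerMeasure (A ∩ E) + outerMeasure (A ∩ ∁ E) ≤ s
    superadditive A s I covers I≤s = ≤.≤-respʳ-≈ (x-y+y≈x s _) (+-monoˡ-≤ _ A∩E≤)
      where
      L R : ℕ → Interval
      L k = proj₁ (split (I k))
      R k = proj₁ (proj₂ (split (I k)))
      -- The prefix lengths are independent because the two covers are bounded one after the other.
      -- Both prefixes are first extended to the longer length, where the widths pair up.
      L+R≤s : ∀ m n → total L m + total R n ≤ s
      L+R≤s m n = ≤.trans
        (+-mono-≤ (total-mono L (ℕ.m≤m⊔n m n)) (total-mono R (ℕ.m≤n⊔m m n)))
        (≤.≤-respˡ-≈ (sym (total-+ I L R (λ k → proj₁ (proj₂ (proj₂ (split (I k))))) (m ℕ.⊔ n)))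
          (I≤s (m ℕ.⊔ n)))
      -- Whatever prefix of L is charged against s, the rest of s pays for all of R.
      A∩∁E≤ : ∀ m → outerMeasure (A ∩ ∁ E) ≤ s - total L m
      A∩∁E≤ m = om-lower {A ∩ ∁ E}
        ( R
        , (λ x (Ax , ¬Ex) → let k , x∈I = covers x Ax in
             k , proj₂ (proj₂ (proj₂ (proj₂ (split (I k))))) x x∈I ¬Ex)
        , λ n → x+z≤y⇒x≤y-z (≤.≤-respˡ-≈ (+-comm _ _) (L+R≤s m n)))
      A∩E≤ : outerMeasure (A ∩ E) ≤ s - outerMeasure (A ∩ ∁ E)
      A∩E≤ = om-lower {A ∩ E}
        ( L
        , (λ x (Ax , Ex) → let k , x∈I = covers x Ax in
             k , proj₁ (proj₂ (proj₂ (proj₂ (split (I k))))) x x∈I Ex)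
        , λ m → x+z≤y⇒x≤y-z (≤.≤-respˡ-≈ (+-comm _ _)
            (≤.≤-respʳ-≈ (x-y+y≈x s _) (+-monoˡ-≤ _ (A∩∁E≤ m)))))

  -- Split `A` by `E` and then `A ∩ E` by `F`. The two parts outside `E ∩ F` are exactly what `E`
  -- makes of `A ∩ ∁ (E ∩ F)`, so they recombine.
  ∩-measurable : ∀ {E F} → Measurable E → Measurable F → Measurable (E ∩ F)
  ∩-measurable {E} {F} (respE , splitE) (respF , splitF) =
    (λ x≈y (Ex , Fx) → respE x≈y Ex , respF x≈y Fx) , λ A → let open ≤-Reasoning in begin-equality
      outerMeasure A
        ≈⟨ splitE A ⟩
      outerMeasure (A ∩ E) + outerMeasure (A ∩ ∁ E)
        ≈⟨ +-congʳ (splitF (A ∩ E)) ⟩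
      outerMeasure ((A ∩ E) ∩ F) + outerMeasure ((A ∩ E) ∩ ∁ F) + outerMeasure (A ∩ ∁ E)
        ≈⟨ +-assoc _ _ _ ⟩
      outerMeasure ((A ∩ E) ∩ F) + (outerMeasure ((A ∩ E) ∩ ∁ F) + outerMeasure (A ∩ ∁ E))
        ≈⟨ +-cong
             (om-cong {(A ∩ E) ∩ F} {A ∩ (E ∩ F)}
               (λ ((a , e) , f) → a , e , f) (λ (a , e , f) → (a , e) , f))
             (+-cong
               (om-cong {(A ∩ E) ∩ ∁ F} {(A ∩ ∁ (E ∩ F)) ∩ E}
                 (λ ((a , e) , ¬f) → (a , ¬f ∘ proj₂) , e)
                 (λ ((a , ¬ef) , e) → (a , e) , λ f → ¬ef (e , f)))
               (om-cong {A ∩ ∁ E} {(A ∩ ∁ (E ∩ F)) ∩ ∁ E}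
                 (λ (a , ¬e) → (a , ¬e ∘ proj₁) , ¬e)
                 (λ ((a , _) , ¬e) → a , ¬e))) ⟩
      outerMeasure (A ∩ (E ∩ F)) +
        (outerMeasure ((A ∩ ∁ (E ∩ F)) ∩ E) + outerMeasure ((A ∩ ∁ (E ∩ F)) ∩ ∁ E))
        ≈⟨ +-congˡ (splitE (A ∩ ∁ (E ∩ F))) ⟨
      outerMeasure (A ∩ (E ∩ F)) + outerMeasure (A ∩ ∁ (E ∩ F)) ∎

  ∁-measurable : ∀ {E} → Decidable E → Measurable E → Measurable (∁ E)
  ∁-measurable {E} E? (respE , splitE) =
    (λ x≈y ¬Ex Ey → ¬Ex (respE (sym x≈y) Ey)) , λ A →
    trans (splitE A) (trans (+-comm _ _) (+-congˡ
      (om-cong {A ∩ E} {A ∩ ∁ (∁ E)} (λ (a , e) → a , λ ¬e → ¬e e)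
        (λ {x} (a , ¬¬e) → a , decidable-stable (E? x) ¬¬e))))

  splitInterval : ∀ p I → Σ[ L ∈ Interval ] Σ[ R ∈ Interval ]
    width L + width R ≈ width I ×
    (∀ x → x ∈ᴵ I → pos x ≤ pos p → x ∈ᴵ L) × (∀ x → x ∈ᴵ I → pos p ≤ pos x → x ∈ᴵ R)
  splitInterval p I with ≤.total (pos p) (pos (lo I)) | ≤.total (pos p) (pos (hi I))
  ... | inj₁ p≤lo | _ =
    single (lo I) , I , trans (+-congʳ (width-single (lo I))) (+-identityˡ _) ,
    -- Since `x ≤ p ≤ lo I ≤ x`, only the left endpoint of `I` can lie in this part, and a single
    -- point covers it.
    (λ x (lo≤x , _) x≤p → edge⇒≤ (loIn? I) lo≤x , ≤.trans x≤p p≤lo) , λ _ x∈I _ → x∈I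
  ... | inj₂ lo≤p | inj₁ p≤hi =
    closed (lo I) p lo≤p , closed p (hi I) p≤hi ,
    trans (solve 4 (λ p -l h -p → (p :+ -l) :+ (h :+ -p) := (h :+ -l) :+ (p :+ -p)) refl _ _ _ _)
      (trans (+-congˡ (-‿inverseʳ (pos p))) (+-identityʳ _)) ,
    (λ x (lo≤x , _) x≤p → edge⇒≤ (loIn? I) lo≤x , x≤p) ,
    (λ x (_ , x≤hi) p≤x → p≤x , edge⇒≤ (hiIn? I) x≤hi)
  ... | inj₂ _ | inj₂ hi≤p =
    I , single (hi I) , trans (+-congˡ (width-single (hi I))) (+-identityʳ _) ,
    (λ _ x∈I _ → x∈I) , λ x (_ , x≤hi) p≤x → ≤.trans hi≤p p≤x , edge⇒≤ (hiIn? I) x≤hi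

  edge? : ∀ b x y → Relation.Nullary.Dec (edge b x y)
  edge? true  x y = x ≤? y
  edge? false x y = (x ≤? y) ×-dec ¬? (x ≤.≟ y)

  ¬edge⇒≥ : ∀ b {x y} → ¬ edge b x y → y ≤ x
  ¬edge⇒≥ true  x≰y = ≰⇒≥ x≰y
  ¬edge⇒≥ false {x} {y} x≮y = decidable-stable (y ≤? x) λ y≰x → x≮y (≰⇒> y≰x)

  edge-respʳ : ∀ b {x y z} → y ≈ z → edge b x y → edge b x z
  edge-respʳ true  = ≤.≤-respʳ-≈
  edge-respʳ false = <-respʳ-≈

  edge-respˡ : ∀ b {x y z} → y ≈ z → edge b y x → edge b z x
  edge-respˡ true  = ≤.≤-respˡ-≈
  edge-respˡ false = <-respˡ-≈

  _∈ᴵ?_ : ∀ x I → Relation.Nullary.Dec (x ∈ᴵ I)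
  x ∈ᴵ? I = edge? (loIn? I) _ _ ×-dec edge? (hiIn? I) _ _

  -- An interval is the intersection of two half-lines, and a half-line splits any interval at its
  -- own endpoint.
  interval-measurable : ∀ I → Measurable (_∈ᴵ I)
  interval-measurable I = ∩-measurable
    (splits⇒measurable (λ x → edge? (loIn? I) (pos (lo I)) (pos x)) (edge-respʳ (loIn? I)) λ J →
      let L , R , eq , toL , toR = splitInterval (lo I) J in
      R , L , trans (+-comm _ _) eq
        , (λ x x∈J lo≤x → toR x x∈J (edge⇒≤ (loIn? I) lo≤x))
        , (λ x x∈J lo≰x → toL x x∈J (¬edge⇒≥ (loIn? I) lo≰x)))
    (splits⇒measurable (λ x → edge? (hiIn? I) (pos x) (pos (hi I))) (edge-respˡ (hiIn? I)) λ J →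
      let L , R , eq , toL , toR = splitInterval (hi I) J in
      L , R , eq
        , (λ x x∈J x≤hi → toL x x∈J (edge⇒≤ (hiIn? I) x≤hi))
        , (λ x x∈J x≰hi → toR x x∈J (¬edge⇒≥ (hiIn? I) x≰hi)))

  ⊥-All⁻ : ∀ I {S} → All (λ J → (_∈ᴵ I) ⊥ (_∈ᴵ J)) S → ∀ x → x ∈ᴵ I → ¬ ⟦ S ⟧ x
  ⊥-All⁻ I (I⊥J ∷ _)   x x∈I (here x∈J)  = I⊥J {x} (x∈I , x∈J)
  ⊥-All⁻ I (_   ∷ I⊥S) x x∈I (there x∈S) = ⊥-All⁻ I I⊥S x x∈I x∈S

  ⊥-All⁺ : ∀ I S → (∀ x → x ∈ᴵ I → ¬ ⟦ S ⟧ x) → All (λ J → (_∈ᴵ I) ⊥ (_∈ᴵ J)) S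
  ⊥-All⁺ I []      I⊥S = []
  ⊥-All⁺ I (J ∷ S) I⊥S = (λ {x} (x∈I , x∈J) → I⊥S x x∈I (here x∈J))
                     ∷ ⊥-All⁺ I S λ x x∈I x∈S → I⊥S x x∈I (there x∈S)

-- Additivity of the integral and of valuations

module Integral (ℝ : Reals) where

  open Reals ℝ
  open OrderedField ℝ
  open CakeCutting ℝ
  open Measure ℝ
  open Algebra.Properties.CommutativeSemigroup +-commutativeSemigroup using (interchange)

  ∫-isSup : ∀ S v → IsSupremum (LowerSum (value v) S) (∫[ S ] v)
  ∫-isSup S v = proj₂ (supremum (LowerSum (value v) S) _ _)

  ∫-mono : ∀ v {S T} → S ⊆ T → ∫[ S ] v ≤ ∫[ T ] v
  ∫-mono v {S} {T} S⊆T = proj₂ (∫-isSup S v) _ λ y (φ , disjoint , inS , y≈) →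
    proj₁ (∫-isSup T v) y (φ , disjoint , All.map (λ r⊆S {_} x∈r → S⊆T (r⊆S x∈r)) inS , y≈)

  module _ {f : Cake → Carrier} where

    weight : Step f → Carrier
    weight s = height s * outerMeasure (region s)

    restrict : ∀ {E} → Measurable E → Step f → Step f
    restrict {E} E-meas s = record
      { region     = region s ∩ E
      ; measurable = ∩-measurable (Step.measurable s) E-meas
      ; height     = height s
      ; 0≤height   = Step.0≤height s
      ; height≤f   = λ x (x∈s , _) → Step.height≤f s x x∈s
      }

    lowerSum-restrict : ∀ {S E} (E-meas : Measurable E) φ →
      AllPairs (λ s t → region s ⊥ region t) φ → All (λ s → region s ⊆ S) φ →
      LowerSum f (S ∩ E) (Σℝ (map weight (map (restrict E-meas) φ)))
    lowerSum-restrict E-meas φ disjoint inS =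
      map (restrict E-meas) φ ,
      AllPairs.map⁺ (AllPairs.map (λ s⊥t {_} ((x∈s , _) , (x∈t , _)) → s⊥t (x∈s , x∈t)) disjoint) ,
      All.map⁺ (All.map (λ s⊆S {_} (x∈s , x∈E) → s⊆S x∈s , x∈E) inS) ,
      refl

    -- This is Carathéodory's equality for `E`, with the region of each step as the test set.
    Σ-restrict : ∀ {E} (E-meas : Measurable E) (∁E-meas : Measurable (∁ E)) φ →
      Σℝ (map weight φ) ≈
      Σℝ (map weight (map (restrict E-meas) φ)) + Σℝ (map weight (map (restrict ∁E-meas) φ))
    Σ-restrict E-meas ∁E-meas []      = sym (+-identityʳ 0#)
    Σ-restrict E-meas ∁E-meas (s ∷ φ) = trans
      (+-cong (trans (*-congˡ (proj₂ E-meas (region s))) (distribˡ (height s) _ _))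
              (Σ-restrict E-meas ∁E-meas φ))
      (interchange _ _ _ _)

    -- Inside `J` every region has outer measure at most `width J`. The sum of the heights is thus a
    -- Lipschitz constant for the simple function's integral, as `uniformly-continuous` requires.
    Σ-restrict-≤ : ∀ J (J-meas : Measurable (_∈ᴵ J)) φ →
      Σℝ (map weight (map (restrict J-meas) φ)) ≤ Σℝ (map height φ) * width J
    Σ-restrict-≤ J J-meas []      = ≤.reflexive (sym (zeroˡ _))
    Σ-restrict-≤ J J-meas (s ∷ φ) = ≤.≤-respʳ-≈ (sym (distribʳ _ _ _))
      (+-mono-≤ (*-monoʳ-≤ (Step.0≤height s) (om-interval {region s ∩ (_∈ᴵ J)} J proj₂))
                (Σ-restrict-≤ J J-meas φ))

    heights-nonNeg : (φ : List (Step f)) → 0# ≤ Σℝ (map height φ)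
    heights-nonNeg []      = ≤.refl
    heights-nonNeg (s ∷ φ) = +-nonNeg (Step.0≤height s) (heights-nonNeg φ)

  -- Simple functions supported in `S` and in `T` have disjoint regions, so their lists concatenate
  -- to a simple function on `R`.
  ∫-superadditive : ∀ v {S T R} → S ⊥ T → S ⊆ R → T ⊆ R → ∫[ S ] v + ∫[ T ] v ≤ ∫[ R ] v
  ∫-superadditive v {S} {T} {R} S⊥T S⊆R T⊆R =
    sup-+-≤ (∫-isSup S v) λ y ySum → ≤.≤-respˡ-≈ (+-comm _ _)
      (sup-+-≤ (∫-isSup T v) λ z zSum → proj₁ (∫-isSup R v) _ (join ySum zSum))
    where
    join : ∀ {y z} → LowerSum (value v) S y → LowerSum (value v) T z → LowerSum (value v) R (z + y)
    join (φ , φ-disjoint , φ⊆S , y≈) (ψ , ψ-disjoint , ψ⊆T , z≈) =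
      φ ++ ψ ,
      AllPairs.++⁺ φ-disjoint ψ-disjoint
        (All.map (λ s⊆S → All.map (λ t⊆T {_} (x∈s , x∈t) → S⊥T (s⊆S x∈s , t⊆T x∈t)) ψ⊆T) φ⊆S) ,
      All.++⁺ (All.map (λ s⊆S {_} x∈s → S⊆R (s⊆S x∈s)) φ⊆S)
              (All.map (λ t⊆T {_} x∈t → T⊆R (t⊆T x∈t)) ψ⊆T) ,
      trans (+-comm _ _) (trans (+-cong y≈ z≈) (sym (Σ-++ φ)))
      where
      Σ-++ : ∀ φ → Σℝ (map weight (φ ++ ψ)) ≈ Σℝ (map weight φ) + Σℝ (map weight ψ)
      Σ-++ []      = sym (+-identityˡ _)
      Σ-++ (s ∷ φ) = trans (+-congˡ (Σ-++ φ)) (sym (+-assoc _ _ _))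

  ∁-interval-measurable : ∀ J → Measurable (∁ (_∈ᴵ J))
  ∁-interval-measurable J = ∁-measurable (_∈ᴵ? J) (interval-measurable J)

  -- The measurability of `J` cuts every simple function on `S` into one inside `J` and one outside
  -- it, and the latter lives on `T`.
  ∫-subadditive : ∀ v J {S T} → (∀ x → S x → x ∈ᴵ J ⊎ T x) → ∫[ S ] v ≤ ∫[ _∈ᴵ J ] v + ∫[ T ] v
  ∫-subadditive v J {S} {T} S⊆J∪T = proj₂ (∫-isSup S v) _ λ y (φ , disjoint , φ⊆S , y≈) →
    ≤.≤-respˡ-≈ (sym (trans y≈ (Σ-restrict (interval-measurable J) (∁-interval-measurable J) φ)))
      (+-mono-≤
        (≤.trans
          (proj₁ (∫-isSup (S ∩ (_∈ᴵ J)) v) _ (lowerSum-restrict (interval-measurable J) φ disjoint φ⊆S))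
          (∫-mono v {S ∩ (_∈ᴵ J)} {_∈ᴵ J} proj₂))
        (≤.trans
          (proj₁ (∫-isSup (S ∩ ∁ (_∈ᴵ J)) v) _ (lowerSum-restrict (∁-interval-measurable J) φ disjoint φ⊆S))
          (∫-mono v {S ∩ ∁ (_∈ᴵ J)} {T} λ {x} (Sx , x∉J) → [ (λ x∈J → contradiction x∈J x∉J) , id ]′ (S⊆J∪T x Sx))))

  -- The empty set is disjoint from itself, so twice its integral is at most its integral.
  V-[] : ∀ v → V v [] ≤ 0#
  V-[] v = +-cancelˡ-≤ (V v []) (≤.≤-respʳ-≈ (sym (+-identityʳ _))
    (∫-superadditive v {⟦ [] ⟧} {⟦ [] ⟧} {⟦ [] ⟧} (λ ()) id id))

  V-nonNeg : ∀ v S → 0# ≤ V v S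
  V-nonNeg v S = proj₁ (∫-isSup ⟦ S ⟧ v) 0# ([] , [] , [] , refl)

  V-[]≈0 : ∀ v → V v [] ≈ 0#
  V-[]≈0 v = ≤.antisym (V-[] v) (V-nonNeg v [])

  V-sub : ∀ v {I J R} → ⟦ R ⟧ ⊆ (λ x → x ∈ᴵ I ⊎ ⟦ J ⟧ x) → V v R ≤ V v [ I ] + V v J
  V-sub v {I} {J} {R} R⊆I∪J = ≤.trans
    (∫-subadditive v I {⟦ R ⟧} {⟦ J ⟧} λ x x∈R → R⊆I∪J {x} x∈R)
    (+-monoˡ-≤ _ (∫-mono v {_∈ᴵ I} {⟦ [ I ] ⟧} here))

  V-∷ : ∀ v {I S} → All (λ J → (_∈ᴵ I) ⊥ (_∈ᴵ J)) S → V v (I ∷ S) ≈ V v [ I ] + V v S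
  V-∷ v {I} {S} I⊥S = ≤.antisym
    (V-sub v {I} {S} {I ∷ S} λ { (here x∈I) → inj₁ x∈I ; (there x∈S) → inj₂ x∈S })
    (∫-superadditive v {⟦ [ I ] ⟧} {⟦ S ⟧} {⟦ I ∷ S ⟧}
      (λ { {x} (here x∈I , x∈S) → ⊥-All⁻ I I⊥S x x∈I x∈S }) (λ { (here x∈I) → here x∈I }) there)

  -- The intervals of `S` are split off one at a time, because `∫-subadditive` separates a single
  -- interval from the rest.
  V-++ : ∀ v S {T} → IsPiece (S ++ T) → V v (S ++ T) ≈ V v S + V v T
  V-++ v []      {T} _                = sym (trans (+-congʳ (V-[]≈0 v)) (+-identityˡ (V v T)))
  V-++ v (I ∷ S) {T} (I⊥S++T ∷ piece) = begin-equality
    V v (I ∷ S ++ T)               ≈⟨ V-∷ v {I} {S ++ T} I⊥S++T ⟩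
    V v [ I ] + V v (S ++ T)       ≈⟨ +-congˡ (V-++ v S piece) ⟩
    V v [ I ] + (V v S + V v T)    ≈⟨ +-assoc _ _ _ ⟨
    V v [ I ] + V v S + V v T      ≈⟨ +-congʳ (V-∷ v {I} {S} (All.++⁻ˡ S I⊥S++T)) ⟨
    V v (I ∷ S) + V v T            ∎
    where open ≤-Reasoning

  V-concat : ∀ v Ps → IsPiece (concat Ps) → V v (concat Ps) ≈ Σℝ (map (V v) Ps)
  V-concat v []       _     = V-[]≈0 v
  V-concat v (P ∷ Ps) piece = trans (V-++ v P piece) (+-congˡ (V-concat v Ps (proj₁ (proj₂ (AllPairs-++⁻ P piece)))))

-- Continuity of valuations and the root's equal division

module EqualDivision (ℝ : Reals) where

  open Reals ℝ
  open OrderedField ℝ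
  open CakeCutting ℝ
  open Measure ℝ
  open Integral ℝ
  open Algebra.Properties.Ring ring using (//-rightDividesʳ; +-cancelˡ)

  wholeCake-full : ∀ x → x ∈ᴵ wholeCake
  wholeCake-full x = 0≤pos x , pos≤1 x

  -- A lower sum within ε of the whole integral is Lipschitz in the interval, and
  -- what it misses on an interval is at most what it misses on the cake.
  uniformly-continuous : ∀ v {ε} → 0# < ε →
    ¬ ¬ (∃[ δ ] 0# < δ × ∀ J → width J ≤ δ → V v [ J ] < ε)
  uniformly-continuous v {ε} 0<ε none =
    sup-approx (∫-isSup ⟦ [ wholeCake ] ⟧ v) 0<ε λ (y , (φ , disjoint , inW , y≈) , V<y+ε) →
      let
        H = Σℝ (map height φ)
        gap = y + ε - V v [ wholeCake ]
        -- Adding 1 to `H` keeps the divisor positive and leaves a spare `δ` in the estimate, which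
        -- makes the final inequality strict.
        δ , 0<δ , H+1*δ≈gap = quotient-pos (0<x+1 (heights-nonNeg φ)) (x<y⇒0<y-x V<y+ε)
      in none (δ , 0<δ , λ J w≤δ →
        let
          open ≤-Reasoning
          outside = ⟦ [ wholeCake ] ⟧ ∩ ∁ (_∈ᴵ J)
          J-meas = interval-measurable J
          ∁J-meas = ∁-interval-measurable J
          y≤ : y ≤ H * width J + ∫[ outside ] v
          y≤ = ≤.≤-respˡ-≈ (sym (trans y≈ (Σ-restrict J-meas ∁J-meas φ)))
            (+-mono-≤ (Σ-restrict-≤ J J-meas φ)
              (proj₁ (∫-isSup outside v) _ (lowerSum-restrict ∁J-meas φ disjoint inW)))
          V+∫≤V : V v [ J ] + ∫[ outside ] v ≤ V v [ wholeCake ]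
          V+∫≤V = ∫-superadditive v {⟦ [ J ] ⟧} {outside} {⟦ [ wholeCake ] ⟧}
            (λ { (here x∈J , _ , x∉J) → x∉J x∈J }) (λ {x} _ → here (wholeCake-full x)) proj₁
          V+δ≤ε : V v [ J ] + δ ≤ ε
          V+δ≤ε = +-cancelʳ-≤ (H * δ + ∫[ outside ] v) (begin
            V v [ J ] + δ + (H * δ + ∫[ outside ] v)
              ≈⟨ solve 4 (λ a d h i → a :+ d :+ (h :+ i) := (h :+ d) :+ (a :+ i)) refl (V v [ J ]) δ (H * δ) (∫[ outside ] v) ⟩
            (H * δ + δ) + (V v [ J ] + ∫[ outside ] v)
              ≤⟨ +-monoʳ-≤ _ V+∫≤V ⟩
            (H * δ + δ) + V v [ wholeCake ]
              ≈⟨ +-congʳ (trans (+-congˡ (sym (*-identityˡ δ))) (sym (distribʳ δ H 1#))) ⟩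
            (H + 1#) * δ + V v [ wholeCake ]
              ≈⟨ trans (+-congʳ H+1*δ≈gap) (x-y+y≈x _ _) ⟩
            y + ε
              ≤⟨ +-monoˡ-≤ ε (≤.trans y≤ (+-monoˡ-≤ _ (*-monoʳ-≤ (heights-nonNeg φ) w≤δ))) ⟩
            H * δ + ∫[ outside ] v + ε
              ≈⟨ +-comm _ _ ⟩
            ε + (H * δ + ∫[ outside ] v) ∎)
        in ≰⇒> λ ε≤V → x+δ≰x 0<δ (≤.trans V+δ≤ε ε≤V))

  halfOpen : (a b : Cake) → pos a ≤ pos b → Interval
  halfOpen a b a≤b = interval a b a≤b true false

  module _ (μ : Interval → Carrier)
           (μ-sub : ∀ I J K → (∀ x → x ∈ᴵ K → x ∈ᴵ I ⊎ x ∈ᴵ J) → μ K ≤ μ I + μ J)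
           (μ-empty : ∀ I → (∀ x → ¬ x ∈ᴵ I) → μ I ≤ 0#)
           (μ-continuous : ∀ {ε} → 0# < ε → ¬ ¬ (∃[ δ ] 0# < δ × ∀ J → width J ≤ δ → μ J < ε))
           where

    -- The intermediate value theorem for p ↦ μ [a, p): take the supremum of the p
    -- at which the value is at most c.
    cutPoint : ∀ a b a≤b {c} → 0# ≤ c → c ≤ μ (closed a b a≤b) →
      Σ[ p ∈ Cake ] Σ[ a≤p ∈ pos a ≤ pos p ] pos p ≤ pos b × μ (halfOpen a p a≤p) ≈ c
    cutPoint a b a≤b {c} 0≤c c≤μ = p , a≤s , s≤b ,
      ≤.antisym (decidable-stable (F ≤? c) F≰c-absurd) (decidable-stable (c ≤? F) c≰F-absurd)
      where
      at : ∀ {x} → pos a ≤ x → x ≤ pos b → Cake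
      at {x} a≤x x≤b = point x (≤.trans (0≤pos a) a≤x) (≤.trans x≤b (pos≤1 b))
      Low : Pred Carrier (lsuc 0ℓ)
      Low x = Lift (lsuc 0ℓ)
        (Σ[ a≤x ∈ pos a ≤ x ] Σ[ x≤b ∈ x ≤ pos b ] μ (halfOpen a (at a≤x x≤b) a≤x) ≤ c)
      low-a : Low (pos a)
      low-a = lift (≤.refl , a≤b , ≤.trans
        (μ-empty _ λ x (a≤x , x<a) → <⇒≱ x<a a≤x)
        0≤c)
      sup : ∃ (IsSupremum Low)
      sup = supremum Low (pos a , low-a) (pos b , λ { x (lift (_ , x≤b , _)) → x≤b })
      s : Carrier
      s = proj₁ sup
      a≤s : pos a ≤ s
      a≤s = proj₁ (proj₂ sup) _ low-a
      s≤b : s ≤ pos b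
      s≤b = proj₂ (proj₂ sup) _ λ { x (lift (_ , x≤b , _)) → x≤b }
      p : Cake
      p = at a≤s s≤b
      F : Carrier
      F = μ (halfOpen a p a≤s)

      too-small : ∀ {x y z w} → y ≤ x + w → x ≤ z → ¬ w < y - z
      too-small {w = w} y≤x+w x≤z w<y-z = <⇒≱ w<y-z
        (x≤y+z⇒x-z≤y (≤.≤-respʳ-≈ (+-comm _ _) (≤.trans y≤x+w (+-monoˡ-≤ w x≤z))))

      beside : ∀ (p q : Cake) a≤p a≤q (p≤q : pos p ≤ pos q) x → x ∈ᴵ halfOpen a q a≤q →
               x ∈ᴵ halfOpen a p a≤p ⊎ x ∈ᴵ closed p q p≤q
      beside p q a≤p a≤q p≤q x (a≤x , x<q) with pos p ≤? pos x
      ... | yes p≤x = inj₂ (p≤x , proj₁ x<q)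
      ... | no  p≰x = inj₁ (a≤x , ≰⇒> p≰x)

      beside-closed : ∀ x → x ∈ᴵ closed a b a≤b → x ∈ᴵ halfOpen a p a≤s ⊎ x ∈ᴵ closed p b s≤b
      beside-closed x (a≤x , x≤b) with s ≤? pos x
      ... | yes s≤x = inj₂ (s≤x , x≤b)
      ... | no  s≰x = inj₁ (a≤x , ≰⇒> s≰x)

      -- Take `δ` such that intervals of width at most `δ` are worth less than `F - c`. A `Low`
      -- point within `δ` of `s` would give `[a, s)` a value below `F`, so all `Low` points stay `δ`
      -- below their supremum.
      F≰c-absurd : ¬ ¬ F ≤ c
      F≰c-absurd F≰c = μ-continuous (x<y⇒0<y-x (≰⇒> F≰c)) λ (δ , 0<δ , small) →
        x+δ≰x 0<δ (sup-+-≤ (proj₂ sup) λ { x low@(lift (a≤x , x≤b , μ≤c)) →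
          let q   = at a≤x x≤b
              x≤s = proj₁ (proj₂ sup) x low
          in decidable-stable (x + δ ≤? s) λ x+δ≰s →
            too-small (μ-sub _ _ _ (beside q p a≤x a≤s x≤s)) μ≤c
              (small (closed q p x≤s) (x≤y+z⇒x-z≤y (≤.≤-respʳ-≈ (+-comm x δ) (≰⇒≥ x+δ≰s)))) })

      -- Now short intervals are worth less than `c - F`. Either `s + δ` is still in the interval
      -- and is `Low`, although it exceeds the supremum, or `b` is so close to `s` that all of
      -- `[a, b]` is worth less than `c`.
      c≰F-absurd : ¬ ¬ c ≤ F
      c≰F-absurd c≰F = μ-continuous (x<y⇒0<y-x (≰⇒> c≰F)) absurd
        where
        absurd : ¬ (∃[ δ ] 0# < δ × ∀ J → width J ≤ δ → μ J < c - F)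
        absurd (δ , 0<δ , small) with s + δ ≤? pos b
        ... | no s+δ≰b = too-small (≤.trans c≤μ (μ-sub _ _ _ beside-closed)) ≤.refl
          (small (closed p b s≤b) (x≤y+z⇒x-z≤y (≤.≤-respʳ-≈ (+-comm s δ) (≰⇒≥ s+δ≰b))))
        ... | yes s+δ≤b = x+δ≰x 0<δ (proj₁ (proj₂ sup) _ (lift (a≤s+δ , s+δ≤b ,
          (begin
            μ (halfOpen a q a≤s+δ)
              ≤⟨ μ-sub _ _ _ (beside p q a≤s a≤s+δ s≤s+δ) ⟩
            F + μ (closed p q s≤s+δ)
              ≤⟨ +-monoʳ-≤ F (proj₁ (small (closed p q s≤s+δ)
                   (≤.reflexive (trans (+-congʳ (+-comm s δ)) (//-rightDividesʳ s δ))))) ⟩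
            F + (c - F)
              ≈⟨ trans (+-comm F (c - F)) (x-y+y≈x c F) ⟩
            c ∎))))
          where
          open ≤-Reasoning
          s≤s+δ = x≤x+y (proj₁ 0<δ)
          a≤s+δ = ≤.trans a≤s s≤s+δ
          q = at a≤s+δ s+δ≤b

    module _ (μ-cut : ∀ a p b (a≤p : pos a ≤ pos p) (p≤b : pos p ≤ pos b) a≤b →
                μ (closed a b a≤b) ≈ μ (halfOpen a p a≤p) + μ (closed p b p≤b))
             (μ-nonNeg : ∀ I → 0# ≤ μ I)
             where

      -- The leftmost share of value `c` is cut off first. By additivity at the cut point the
      -- remainder is worth `suc n · c`, so the induction continues there.
      equalCuts : ∀ n a b a≤b {c} → 0# ≤ c → suc n · c ≈ μ (closed a b a≤b) →
        ∃[ Is ] length Is ≡ suc n × Cuts n [ closed a b a≤b ] Is × All (λ I → μ I ≈ c) Is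
      equalCuts zero    a b a≤b {c} 0≤c 1c≈μ =
        [ closed a b a≤b ] , ≡.refl , [] , trans (sym 1c≈μ) (+-identityʳ c) ∷ []
      equalCuts (suc n) a b a≤b {c} 0≤c nc≈μ
        with cutPoint a b a≤b 0≤c (≤.≤-respʳ-≈ nc≈μ (x≤x+y (·-nonNeg (suc n) 0≤c)))
      ... | p , a≤p , p≤b , μL≈c =
        let Is , number , cuts , equal = equalCuts n p b p≤b 0≤c μR≈
        in halfOpen a p a≤p ∷ Is , ≡.cong suc number ,
           -- The flag `false` gives `p` to the right part, so the remainder is again a closed
           -- interval.
           here p (a≤p , p≤b) false ∷ Cuts-∷ cuts , μL≈c ∷ equal
        where
        μR≈ : suc n · c ≈ μ (closed p b p≤b)
        μR≈ = +-cancelˡ c _ _ (trans nc≈μ (trans (μ-cut a p b a≤p p≤b a≤b) (+-congʳ μL≈c)))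
        Cuts-∷ : ∀ {k I S S′} → Cuts k S S′ → Cuts k (I ∷ S) (I ∷ S′)
        Cuts-∷ []           = []
        Cuts-∷ (cut ∷ cuts) = there cut ∷ Cuts-∷ cuts

  V-sub-interval : ∀ v I J K → (∀ x → x ∈ᴵ K → x ∈ᴵ I ⊎ x ∈ᴵ J) → V v [ K ] ≤ V v [ I ] + V v [ J ]
  V-sub-interval v I J K K⊆I∪J = V-sub v {I} {[ J ]} {[ K ]} λ { {x} (here x∈K) →
    [ inj₁ , inj₂ ∘ here ]′ (K⊆I∪J x x∈K) }

  V-cut : ∀ v a p b (a≤p : pos a ≤ pos p) (p≤b : pos p ≤ pos b) a≤b →
    V v [ closed a b a≤b ] ≈ V v [ halfOpen a p a≤p ] + V v [ closed p b p≤b ]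
  V-cut v a p b a≤p p≤b a≤b = ≤.antisym
    (V-sub-interval v L R I λ x (a≤x , x≤b) → split x a≤x x≤b)
    (∫-superadditive v {⟦ [ L ] ⟧} {⟦ [ R ] ⟧} {⟦ [ I ] ⟧}
      (λ { (here (_ , x<p) , here (p≤x , _)) → <⇒≱ x<p p≤x })
      (λ { (here (a≤x , x<p)) → here (a≤x , ≤.trans (proj₁ x<p) p≤b) })
      (λ { (here (p≤x , x≤b)) → here (≤.trans a≤p p≤x , x≤b) }))
    where
    I L R : Interval
    I = closed a b a≤b
    L = halfOpen a p a≤p
    R = closed p b p≤b
    split : ∀ x → pos a ≤ pos x → pos x ≤ pos b → x ∈ᴵ L ⊎ x ∈ᴵ R
    split x a≤x x≤b with pos p ≤? pos x
    ... | yes p≤x = inj₂ (p≤x , x≤b)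
    ... | no  p≰x = inj₁ (a≤x , ≰⇒> p≰x)

  equalDivision : ∀ v n → ∃[ Ps ] length Ps ≡ suc n × Division n [ wholeCake ] Ps ×
                                 AllPairs (λ P Q → V v P ≈ V v Q) Ps
  equalDivision v n =
    let
      c , 0≤c , nc≈V = ·-quotient n (V-nonNeg v [ wholeCake ])
      Is , number , cuts , equal = equalCuts (λ I → V v [ I ]) (V-sub-interval v) empty
        (uniformly-continuous v) (V-cut v) (λ I → V-nonNeg v [ I ]) n _ _ 0≤1 0≤c nc≈V
    in map [_] Is , ≡.trans (length-map [_] Is) number ,
       (Is , cuts , ↭-reflexive (≡.sym (concat-map-[_] Is))) ,
       AllPairs.map⁺ (allEqual equal)
    where
    empty : ∀ I → (∀ x → ¬ x ∈ᴵ I) → V v [ I ] ≤ 0#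
    empty I ∉I = ≤.trans
      (∫-mono v {⟦ [ I ] ⟧} {⟦ [] ⟧} λ { {x} (here x∈I) → contradiction x∈I (∉I x) }) (V-[] v)
    allEqual : ∀ {Is c} → All (λ I → V v [ I ] ≈ c) Is →
               AllPairs (λ I J → V v [ I ] ≈ V v [ J ]) Is
    allEqual []            = []
    allEqual (I≈c ∷ Is≈c) = All.map (λ J≈c → trans I≈c (sym J≈c)) Is≈c ∷ allEqual Is≈c

-- Cuts and reorderings preserve pieces and their points

module Pieces (ℝ : Reals) where

  open Reals ℝ
  open OrderedField ℝ
  open CakeCutting ℝ
  open Measure ℝ

  ⊥-sym : ∀ {P Q : Pred Cake 0ℓ} → P ⊥ Q → Q ⊥ P
  ⊥-sym P⊥Q (x∈Q , x∈P) = P⊥Q (x∈P , x∈Q)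

  IsPiece-resp-↭ : ∀ {S S′} → S ↭ S′ → IsPiece S → IsPiece S′
  IsPiece-resp-↭ S↭S′ = AllPairs-resp-↭ (≡.setoid Interval) (λ {I} {J} → ⊥-sym {_∈ᴵ I} {_∈ᴵ J})
    ((λ { ≡.refl → id }) , (λ { ≡.refl → id })) (↭⇒↭ₛ S↭S′)

  IsPiece-++⁻ : ∀ S {T} → IsPiece (S ++ T) → IsPiece S × IsPiece T × ⟦ S ⟧ ⊥ ⟦ T ⟧
  IsPiece-++⁻ S {T} piece =
    let S-piece , T-piece , S⊥T = AllPairs-++⁻ S piece
    in S-piece , T-piece , λ {x} (x∈S , x∈T) → disjoint S⊥T x x∈S x∈T
    where
    disjoint : ∀ {S} → All (λ I → All (λ J → (_∈ᴵ I) ⊥ (_∈ᴵ J)) T) S → ∀ x → ⟦ S ⟧ x → ¬ ⟦ T ⟧ x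
    disjoint {I ∷ _} (I⊥T ∷ _)   x (here x∈I)  x∈T = ⊥-All⁻ I I⊥T x x∈I x∈T
    disjoint {_ ∷ _} (_   ∷ S⊥T) x (there x∈S) x∈T = disjoint S⊥T x x∈S x∈T

  -- The invariant shared by a cut and a permutation. It composes, so it passes to every `Division`,
  -- which is a chain of cuts followed by a permutation.
  record Refines (S S′ : Region) : Set where
    field
      isPiece : IsPiece S → IsPiece S′
      ⊆-old   : ∀ x → ⟦ S′ ⟧ x → ⟦ S ⟧ x
      ⊇-old   : ∀ x → ⟦ S ⟧ x → ⟦ S′ ⟧ x
  open Refines public

  ↭⇒Refines : ∀ {S S′} → S ↭ S′ → Refines S S′
  ↭⇒Refines S↭S′ = record
    { isPiece = IsPiece-resp-↭ S↭S′
    ; ⊆-old   = λ x → Any-resp-↭ (↭-sym S↭S′)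
    ; ⊇-old   = λ x → Any-resp-↭ S↭S′
    }

  Refines-trans : ∀ {S S′ S″} → Refines S S′ → Refines S′ S″ → Refines S S″
  Refines-trans r r′ = record
    { isPiece = isPiece r′ ∘ isPiece r
    ; ⊆-old   = λ x x∈S″ → ⊆-old r x (⊆-old r′ x x∈S″)
    ; ⊇-old   = λ x x∈S → ⊇-old r′ x (⊇-old r x x∈S)
    }

  Refines-∷ : ∀ {I S S′} → Refines S S′ → Refines (I ∷ S) (I ∷ S′)
  Refines-∷ {I} {S} {S′} r = record
    { isPiece = λ { (I⊥S ∷ S-piece) →
        ⊥-All⁺ I S′ (λ x x∈I x∈S′ → ⊥-All⁻ I I⊥S x x∈I (⊆-old r x x∈S′)) ∷ isPiece r S-piece }
    ; ⊆-old   = λ { x (here x∈I) → here x∈I ; x (there x∈S′) → there (⊆-old r x x∈S′) }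
    ; ⊇-old   = λ { x (here x∈I) → here x∈I ; x (there x∈S) → there (⊇-old r x x∈S) }
    }

  left-⊆ : ∀ I p p∈I b → (_∈ᴵ left I p p∈I b) ⊆ (_∈ᴵ I)
  left-⊆ I p p∈I b {x} (lo≤x , x≤p) = lo≤x , edge-trans (hiIn? I) x≤p (proj₂ p∈I)
    where
    edge-trans : ∀ b′ {z} → edge b (pos x) (pos p) → edge b′ (pos p) z → edge b′ (pos x) z
    edge-trans true  x≤p p≤z = ≤.trans (edge⇒≤ b x≤p) p≤z
    edge-trans false x≤p p<z = ≰⇒> λ z≤x → <⇒≱ p<z (≤.trans z≤x (edge⇒≤ b x≤p))

  right-⊆ : ∀ I p p∈I b → (_∈ᴵ right I p p∈I b) ⊆ (_∈ᴵ I)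
  right-⊆ I p p∈I b {x} (p≤x , x≤hi) = edge-trans (loIn? I) (proj₁ p∈I) p≤x , x≤hi
    where
    edge-trans : ∀ b′ {z} → edge b′ z (pos p) → edge (not b) (pos p) (pos x) → edge b′ z (pos x)
    edge-trans true  z≤p p≤x = ≤.trans z≤p (edge⇒≤ (not b) p≤x)
    edge-trans false z<p p≤x = ≰⇒> λ x≤z → <⇒≱ z<p (≤.trans (edge⇒≤ (not b) p≤x) x≤z)

  -- Together with `edge-exclusive` this shows that the complementary flags at a cut point put every
  -- point on exactly one side of it.
  edge-split : ∀ b x y → edge b x y ⊎ edge (not b) y x
  edge-split true  x y with x ≤? y
  ... | yes x≤y = inj₁ x≤y
  ... | no  x≰y = inj₂ (≰⇒> x≰y)
  edge-split false x y with y ≤? x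
  ... | yes y≤x = inj₂ y≤x
  ... | no  y≰x = inj₁ (≰⇒> y≰x)

  edge-exclusive : ∀ b {x y} → edge b x y → ¬ edge (not b) y x
  edge-exclusive true  x≤y y<x = <⇒≱ y<x x≤y
  edge-exclusive false x<y y≤x = <⇒≱ x<y y≤x

  Refines-cut : ∀ I p p∈I b S → Refines (I ∷ S) (left I p p∈I b ∷ right I p p∈I b ∷ S)
  Refines-cut I p p∈I b S = record
    { isPiece = λ { (I⊥S ∷ S-piece) →
        ((λ ((_ , x≤p) , (p≤x , _)) → edge-exclusive b x≤p p≤x)
          ∷ ⊥-All⁺ (left I p p∈I b) S λ x x∈L → ⊥-All⁻ I I⊥S x (left-⊆ I p p∈I b {x} x∈L))
        ∷ ⊥-All⁺ (right I p p∈I b) S (λ x x∈R → ⊥-All⁻ I I⊥S x (right-⊆ I p p∈I b {x} x∈R))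
        ∷ S-piece }
    ; ⊆-old = λ { x (here x∈L)         → here (left-⊆ I p p∈I b {x} x∈L)
                ; x (there (here x∈R)) → here (right-⊆ I p p∈I b {x} x∈R)
                ; x (there (there x∈S))    → there x∈S }
    ; ⊇-old = λ { x (here (lo≤x , x≤hi)) →
                    [ (λ x≤p → here (lo≤x , x≤p)) , (λ p≤x → there (here (p≤x , x≤hi))) ]′
                      (edge-split b (pos x) (pos p))
                ; x (there x∈S) → there (there x∈S) }
    }

  Cut⇒Refines : ∀ {S S′} → Cut S S′ → Refines S S′
  Cut⇒Refines (here {I} {S} p p∈I b) = Refines-cut I p p∈I b S
  Cut⇒Refines (there cut)            = Refines-∷ (Cut⇒Refines cut)

  Cuts⇒Refines : ∀ {k S S′} → Cuts k S S′ → Refines S S′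
  Cuts⇒Refines []           = ↭⇒Refines ↭-refl
  Cuts⇒Refines (cut ∷ cuts) = Refines-trans (Cut⇒Refines cut) (Cuts⇒Refines cuts)

  Division⇒Refines : ∀ {k S Xs} → Division k S Xs → Refines S (concat Xs)
  Division⇒Refines (_ , cuts , S′↭Xs) = Refines-trans (Cuts⇒Refines cuts) (↭⇒Refines S′↭Xs)

-- Regrouping lists, and the arithmetic of the cut bound

concat-↭ : ∀ {a} {A : Set a} {xss yss : List (List A)} → xss ↭ yss → concat xss ↭ concat yss
concat-↭ ↭.refl                  = ↭-refl
concat-↭ (↭.prep xs xss↭yss)     = ++⁺ˡ xs (concat-↭ xss↭yss)
concat-↭ (↭.swap xs ys xss↭yss)  =
  ↭-trans (shifts xs ys) (++⁺ˡ ys (++⁺ˡ xs (concat-↭ xss↭yss)))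
concat-↭ (↭.trans xss↭yss yss↭zss) = ↭-trans (concat-↭ xss↭yss) (concat-↭ yss↭zss)

0<size : ∀ T → 0 ℕ.< size T
0<size (node _) = s≤s z≤n

sum-≤ : ∀ {d} (k l s : Fin d → ℕ) → (∀ c → k c ℕ.≤ 2 ℕ.* s c) → (∀ c → l c ℕ.≤ s c ℕ.* s c) →
  let Σs = sum (tabulate s) in
  sum (tabulate λ c → k c ℕ.+ l c) ℕ.≤ 2 ℕ.* Σs ℕ.+ Σs ℕ.* Σs
sum-≤ {zero}  k l s k≤ l≤ = z≤n
sum-≤ {suc d} k l s k≤ l≤ = begin
  k₀ ℕ.+ l₀ ℕ.+ sum (tabulate λ c → k (suc c) ℕ.+ l (suc c))
    ≤⟨ ℕ.+-mono-≤ (ℕ.+-mono-≤ (k≤ zero) (l≤ zero)) (sum-≤ (k ∘ suc) (l ∘ suc) (s ∘ suc) (k≤ ∘ suc) (l≤ ∘ suc)) ⟩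
  2 ℕ.* s₀ ℕ.+ s₀ ℕ.* s₀ ℕ.+ (2 ℕ.* Σs ℕ.+ Σs ℕ.* Σs)
    -- The added term is the cross term of the square of `s₀ + Σs`.
    ≤⟨ ℕ.m≤m+n _ (2 ℕ.* s₀ ℕ.* Σs) ⟩
  2 ℕ.* s₀ ℕ.+ s₀ ℕ.* s₀ ℕ.+ (2 ℕ.* Σs ℕ.+ Σs ℕ.* Σs) ℕ.+ 2 ℕ.* s₀ ℕ.* Σs
    ≡⟨ Nat.solve 2 (λ s t →
         Nat.con 2 Nat.:* s Nat.:+ s Nat.:* s Nat.:+ (Nat.con 2 Nat.:* t Nat.:+ t Nat.:* t)
           Nat.:+ Nat.con 2 Nat.:* s Nat.:* t
         Nat.:= Nat.con 2 Nat.:* (s Nat.:+ t) Nat.:+ (s Nat.:+ t) Nat.:* (s Nat.:+ t)) ≡.refl s₀ Σs ⟩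
  2 ℕ.* (s₀ ℕ.+ Σs) ℕ.+ (s₀ ℕ.+ Σs) ℕ.* (s₀ ℕ.+ Σs) ∎
  where
  open ℕ.≤-Reasoning
  k₀ = k zero
  l₀ = l zero
  s₀ = s zero
  Σs = sum (tabulate (s ∘ suc))

-- Correctness and cut count of a run

module Run (ℝ : Reals) where

  open Reals ℝ
  open OrderedField ℝ
  open CakeCutting ℝ
  open Measure ℝ
  open Integral ℝ
  open Pieces ℝ

  -- An allocation relative to `S`, so that it can be proved by recursion on subtrees. `within`
  -- carries the disjointness of the regions `S c` over to the shares cut from them.
  record Partitions (S : Region) {Agent : Set} (A : Agent → Region) : Set where
    field
      piece    : ∀ i → IsPiece (A i)
      within   : ∀ i x → ⟦ A i ⟧ x → ⟦ S ⟧ x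
      disjoint : ∀ {i j} → i ≢ j → ∀ x → ⟦ A i ⟧ x → ¬ ⟦ A j ⟧ x
      covers   : ∀ x → ⟦ S ⟧ x → ∃[ i ] ⟦ A i ⟧ x

  concat-++-↭ : ∀ {Ps} (Qs Rs : List Region) → Ps ↭ Qs ++ Rs → concat Ps ↭ concat Qs ++ concat Rs
  concat-++-↭ Qs Rs Ps↭ = ↭-trans (concat-↭ Ps↭) (↭-reflexive (≡.sym (concat-++ Qs Rs)))

  module _ {d} {ts : Fin d → Tree} {v : Vertex (node ts) → Density}
           {chosen : Fin d → List Region} {last : Region} where

    S : Fin d → Region
    S c = concat (chosen c)

    -- The state for the children still to pick, `R` being what is left to them. Only the choices of
    -- children in `order` are constrained by `Choosing`, hence the membership conditions.
    record Separates (order : List (Fin d)) (R : Region) : Set where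
      field
        last-piece  : IsPiece last
        last-within : ∀ x → ⟦ last ⟧ x → ⟦ R ⟧ x
        piece       : ∀ {c} → c ∈ order → IsPiece (S c)
        within      : ∀ {c} → c ∈ order → ∀ x → ⟦ S c ⟧ x → ⟦ R ⟧ x
        last-apart  : ∀ {c} → c ∈ order → ∀ x → ⟦ last ⟧ x → ¬ ⟦ S c ⟧ x
        apart       : ∀ {c c′} → c ∈ order → c′ ∈ order → c ≢ c′ → ∀ x → ⟦ S c ⟧ x → ¬ ⟦ S c′ ⟧ x
        covers      : ∀ x → ⟦ R ⟧ x → ⟦ last ⟧ x ⊎ ∃[ c ] ⟦ S c ⟧ x

    -- Each pick divides the current pieces into `S c` and `rest`. Everything assigned later lies
    -- within `rest` and is therefore apart from `S c`.
    choosing-separates : ∀ {order Ps} → Choosing v chosen last order Ps → IsPiece (concat Ps) →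
                         Separates order (concat Ps)
    choosing-separates done Ps-piece = record
      { last-piece  = proj₁ (IsPiece-++⁻ last Ps-piece)
      ; last-within = λ x → Any.++⁺ˡ
      ; piece       = λ ()
      ; within      = λ ()
      ; last-apart  = λ ()
      ; apart       = λ ()
      ; covers      = λ x x∈ → [ inj₁ , (λ ()) ]′ (Any.++⁻ last x∈)
      }
    choosing-separates (pick {c} {order} {Ps} {rest} _ Ps↭ _ choosing) Ps-piece = record
      { last-piece  = last-piece
      ; last-within = λ x x∈last → from-rest x (last-within x x∈last)
      ; piece       = λ { (here ≡.refl) → Sc-piece ; (there c∈) → piece c∈ }
      ; within      = λ { (here ≡.refl) → from-Sc ; (there c∈) → λ x x∈S → from-rest x (within c∈ x x∈S) }
      ; last-apart  = λ { (here ≡.refl) → λ x x∈last x∈Sc → Sc⊥rest {x} (x∈Sc , last-within x x∈last)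
                        ; (there c∈) → last-apart c∈ }
      ; apart       = λ { (here ≡.refl) (here ≡.refl) c≢c → contradiction ≡.refl c≢c
                        ; (here ≡.refl) (there c′∈) _ x x∈Sc x∈S → Sc⊥rest {x} (x∈Sc , within c′∈ x x∈S)
                        ; (there c∈) (here ≡.refl) _ x x∈S x∈Sc → Sc⊥rest {x} (x∈Sc , within c∈ x x∈S)
                        ; (there c∈) (there c′∈) → apart c∈ c′∈ }
      ; covers      = λ x x∈Ps → [ (λ x∈Sc → inj₂ (c , x∈Sc)) , covers x ]′
                        (Any.++⁻ (S c) (Any-resp-↭ Ps↭S++rest x∈Ps))
      }
      where
      Ps↭S++rest : concat Ps ↭ S c ++ concat rest
      Ps↭S++rest = concat-++-↭ (chosen c) rest Ps↭
      parts = IsPiece-++⁻ (S c) {concat rest} (IsPiece-resp-↭ Ps↭S++rest Ps-piece)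
      Sc-piece = proj₁ parts
      Sc⊥rest : ⟦ S c ⟧ ⊥ ⟦ concat rest ⟧
      Sc⊥rest {x} = proj₂ (proj₂ parts) {x}
      open Separates (choosing-separates choosing (proj₁ (proj₂ parts)))
      from-Sc : ∀ x → ⟦ S c ⟧ x → ⟦ concat Ps ⟧ x
      from-Sc x x∈Sc = Any-resp-↭ (↭-sym Ps↭S++rest) (Any.++⁺ˡ x∈Sc)
      from-rest : ∀ x → ⟦ concat rest ⟧ x → ⟦ concat Ps ⟧ x
      from-rest x x∈rest = Any-resp-↭ (↭-sym Ps↭S++rest) (Any.++⁺ʳ (S c) x∈rest)

    last∈ : ∀ {order Ps} → Choosing v chosen last order Ps → last ∈ Ps
    last∈ done                                   = here ≡.refl
    last∈ (pick {c} _ Ps↭ _ choosing) =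
      Any-resp-↭ (↭-sym Ps↭) (Any.++⁺ʳ (chosen c) (last∈ choosing))

    chosen⊆ : ∀ {order Ps c} → Choosing v chosen last order Ps → c ∈ order → ∀ {P} → P ∈ chosen c → P ∈ Ps
    chosen⊆ (pick _ Ps↭ _ _) (here ≡.refl) P∈ = Any-resp-↭ (↭-sym Ps↭) (Any.++⁺ˡ P∈)
    chosen⊆ (pick {c} _ Ps↭ _ choosing) (there c∈) P∈ =
      Any-resp-↭ (↭-sym Ps↭) (Any.++⁺ʳ (chosen c) (chosen⊆ choosing c∈ P∈))

    number-chosen : ∀ {order Ps c} → Choosing v chosen last order Ps → c ∈ order →
                    length (chosen c) ≡ size (ts c)
    number-chosen (pick number _ _ _)   (here ≡.refl) = number
    number-chosen (pick _ _ _ choosing) (there c∈)    = number-chosen choosing c∈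

    -- The piece left for the root is still in `rest` at every pick, so each child had the
    -- opportunity to take it.
    chosen-best : ∀ {order Ps c} → Choosing v chosen last order Ps → c ∈ order →
      All (λ P → V (v (below c root)) last ≤ V (v (below c root)) P) (chosen c)
    chosen-best (pick _ _ best choosing) (here ≡.refl) =
      All.map (λ rest≤P → All.lookup rest≤P (last∈ choosing)) best
    chosen-best (pick _ _ _ choosing) (there c∈) = chosen-best choosing c∈

  austin-refines : ∀ {v w m S k} Xs → AustinCut v w m S Xs k → Refines S (concat Xs)
  austin-refines Xs austin = Division⇒Refines {Xs = Xs} (AustinCut.division austin)

  in-order : ∀ {d} {order : List (Fin d)} → order ↭ allFin d → ∀ c → c ∈ order
  in-order order↭ c = Any-resp-↭ (↭-sym order↭) (∈-allFin c)

  -- Austin's cut refines `S c`, so the shares in the subtree of `c` partition `S c` by recursion.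
  -- Shares from different subtrees are apart because the regions `S c` are.
  algTree-partitions : ∀ {T v Ps A k} → AlgTree T v Ps A k → IsPiece (concat Ps) → Partitions (concat Ps) A
  algTree-partitions (run {d} {ts} {v} {Ps} {A} order order↭ chosen choosing Xs k l austin recur) Ps-piece = record
    { piece    = λ { root → sep.last-piece ; (below c i) → Partitions.piece (sub c) i }
    ; within   = λ { root → sep.last-within ; (below c i) x x∈A → sep.within (∈order c) x (in-S c i x x∈A) }
    ; disjoint = λ {i} {j} → disjoint i j
    ; covers   = λ x x∈Ps → [ (λ x∈last → root , x∈last) , (λ (c , x∈Sc) →
        let i , x∈A = Partitions.covers (sub c) x (⊇-old (austin-refines (Xs c) (austin c)) x x∈Sc)
        in below c i , x∈A) ]′ (sep.covers x x∈Ps)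
    }
    where
    ∈order : ∀ c → c ∈ order
    ∈order = in-order order↭
    module sep = Separates (choosing-separates choosing Ps-piece)
    sub : ∀ c → Partitions (concat (Xs c)) (A ∘ below c)
    sub c = algTree-partitions (recur c) (isPiece (austin-refines (Xs c) (austin c)) (sep.piece (∈order c)))
    in-S : ∀ c i x → ⟦ A (below c i) ⟧ x → ⟦ concat (chosen c) ⟧ x
    in-S c i x x∈A = ⊆-old (austin-refines (Xs c) (austin c)) x (Partitions.within (sub c) i x x∈A)
    disjoint : ∀ i j → i ≢ j → ∀ x → ⟦ A i ⟧ x → ¬ ⟦ A j ⟧ x
    disjoint root        root        i≢j x _ _ = i≢j ≡.refl
    disjoint root        (below c j) _   x x∈A x∈A′ = sep.last-apart (∈order c) x x∈A (in-S c j x x∈A′)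
    disjoint (below c i) root        _   x x∈A x∈A′ = sep.last-apart (∈order c) x x∈A′ (in-S c i x x∈A)
    disjoint (below c i) (below c′ j) i≢j x x∈A x∈A′ with c Fin.≟ c′
    ... | yes ≡.refl = Partitions.disjoint (sub c) (λ { ≡.refl → i≢j ≡.refl }) x x∈A x∈A′
    ... | no  c≢c′   = sep.apart (∈order c) (∈order c′) c≢c′ x (in-S c i x x∈A) (in-S c′ j x x∈A′)

  Indifferent : Density → Pred (List Region) 0ℓ
  Indifferent v Ps = ∀ {P Q} → P ∈ Ps → Q ∈ Ps → V v P ≤ V v Q

  exact⇒indifferent : ∀ v {m} S {Xs} → 0 ℕ.< m → All (λ X → m · V v X ≈ V v S) Xs → Indifferent v Xs
  exact⇒indifferent v S 0<m exact P∈ Q∈ =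
    ·-cancel-≤ 0<m (≤.reflexive (trans (All.lookup exact P∈) (sym (All.lookup exact Q∈))))

  allPairs⇒indifferent : ∀ v {Ps} → AllPairs (λ P Q → V v P ≈ V v Q) Ps → Indifferent v Ps
  allPairs⇒indifferent v (_ ∷ _)    (here ≡.refl) (here ≡.refl) = ≤.refl
  allPairs⇒indifferent v (P≈ ∷ _)   (here ≡.refl) (there Q∈)    = ≤.reflexive (All.lookup P≈ Q∈)
  allPairs⇒indifferent v (Q≈ ∷ _)   (there P∈)    (here ≡.refl) = ≤.reflexive (sym (All.lookup Q≈ P∈))
  allPairs⇒indifferent v (_ ∷ pairs) (there P∈)   (there Q∈)    = allPairs⇒indifferent v pairs P∈ Q∈

  Σℝ-≤ : ∀ (f : Region → Carrier) {x Ps} → All (λ P → f P ≤ x) Ps → Σℝ (map f Ps) ≤ length Ps · x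
  Σℝ-≤ f []            = ≤.refl
  Σℝ-≤ f (fP≤x ∷ Ps≤x) = +-mono-≤ fP≤x (Σℝ-≤ f Ps≤x)

  Σℝ-≥ : ∀ (f : Region → Carrier) {x Ps} → All (λ P → x ≤ f P) Ps → length Ps · x ≤ Σℝ (map f Ps)
  Σℝ-≥ f []            = ≤.refl
  Σℝ-≥ f (x≤fP ∷ x≤Ps) = +-mono-≤ x≤fP (Σℝ-≥ f x≤Ps)

  -- Applied to the recursive run, this makes the share of child `c` one of the parts in `Xs c`, to
  -- which the exactness of Austin's cut applies.
  algTree-root∈ : ∀ {T v Ps A k} → AlgTree T v Ps A k → A root ∈ Ps
  algTree-root∈ (run _ _ _ choosing _ _ _ _ _) = last∈ choosing

  -- On entry to AlgTree the root is indifferent between the pieces; Austin's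
  -- procedure preserves this for each child of the root.
  algTree-envyFree : ∀ {T v Ps A k} → AlgTree T v Ps A k → IsPiece (concat Ps) → Indifferent (v root) Ps →
    ∀ {i j} → i ParentOf j → V (v i) (A j) ≤ V (v i) (A i) × V (v j) (A i) ≤ V (v j) (A j)
  algTree-envyFree (run {ts = ts} {v} order order↭ chosen choosing Xs k l austin recur) Ps-piece indifferent (below c i→j) =
    algTree-envyFree (recur c)
      (isPiece (austin-refines (Xs c) (austin c))
        (Separates.piece (choosing-separates choosing Ps-piece) (in-order order↭ c)))
      -- Child `c` is the root of the recursive run, so the exactness used here is hers, `exact-v`.
      (exact⇒indifferent (v (below c root)) (concat (chosen c)) (0<size (ts c)) (AustinCut.exact-v (austin c)))
      i→j
  algTree-envyFree (run {d} {ts} {v} {Ps} {A} order order↭ chosen choosing Xs k l austin recur) Ps-piece indifferent (top c) =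
    -- Both comparisons are made between multiples by `size (ts c)`: exactness turns that multiple
    -- of the child's share into the value of `S c`, with no division.
    ·-cancel-≤ (0<size (ts c)) root-content , ·-cancel-≤ (0<size (ts c)) child-content
    where
    open ≤-Reasoning
    c∈ = in-order order↭ c
    n = size (ts c)
    X = A (below c root)
    S-piece : IsPiece (concat (chosen c))
    S-piece = Separates.piece (choosing-separates choosing Ps-piece) c∈
    root-content : n · V (v root) X ≤ n · V (v root) (A root)
    root-content = begin
      n · V (v root) X
        ≈⟨ All.lookup (AustinCut.exact-w (austin c)) (algTree-root∈ (recur c)) ⟩
      V (v root) (concat (chosen c))
        ≈⟨ V-concat (v root) (chosen c) S-piece ⟩
      Σℝ (map (V (v root)) (chosen c))
        ≤⟨ Σℝ-≤ (V (v root)) (All.tabulate λ P∈ → indifferent (chosen⊆ choosing c∈ P∈) (last∈ choosing)) ⟩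
      length (chosen c) · V (v root) (A root)
        ≡⟨ ≡.cong (_· V (v root) (A root)) (number-chosen choosing c∈) ⟩
      n · V (v root) (A root) ∎
    child-content : n · V (v (below c root)) (A root) ≤ n · V (v (below c root)) X
    child-content = begin
      n · V (v (below c root)) (A root)
        ≡⟨ ≡.cong (_· V (v (below c root)) (A root)) (number-chosen choosing c∈) ⟨
      length (chosen c) · V (v (below c root)) (A root)
        ≤⟨ Σℝ-≥ (V (v (below c root))) (chosen-best choosing c∈) ⟩
      Σℝ (map (V (v (below c root))) (chosen c))
        ≈⟨ V-concat (v (below c root)) (chosen c) S-piece ⟨
      V (v (below c root)) (concat (chosen c))
        ≈⟨ All.lookup (AustinCut.exact-v (austin c)) (algTree-root∈ (recur c)) ⟨
      n · V (v (below c root)) X ∎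

  algTree-cuts : ∀ {T v Ps A k} → AlgTree T v Ps A k → k ℕ.≤ size T ℕ.* size T
  algTree-cuts (run {ts = ts} _ _ _ _ _ k l austin recur) = ℕ.≤-trans
    (sum-≤ k l (size ∘ ts) (AustinCut.cuts ∘ austin) (algTree-cuts ∘ recur))
    -- With `t` the total size of the children's subtrees, `1 + (2t + t²)` is the square of `1 + t`,
    -- the size of the tree.
    (ℕ.≤-trans (ℕ.n≤1+n _) (ℕ.≤-reflexive
      (Nat.solve 1 (λ t → Nat.con 1 Nat.:+ (Nat.con 2 Nat.:* t Nat.:+ t Nat.:* t)
        Nat.:= (Nat.con 1 Nat.:+ t) Nat.:* (Nat.con 1 Nat.:+ t)) ≡.refl (sum (tabulate (size ∘ ts))))))

  allocationTree-isAllocation : ∀ {T v A k} → AllocationTree T v A k → IsAllocation A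
  allocationTree-isAllocation (run {Ps} _ _ division _ alg) = record
    { piece    = parts.piece
    ; disjoint = λ i≢j {x} (x∈A , x∈A′) → parts.disjoint i≢j x x∈A x∈A′
    ; covers   = λ x → parts.covers x (⊇-old refines x (here (0≤pos x , pos≤1 x)))
    }
    where
    refines : Refines [ wholeCake ] (concat Ps)
    refines = Division⇒Refines {Xs = Ps} division
    module parts = Partitions (algTree-partitions alg (isPiece refines ([] ∷ [])))

  allocationTree-envyFree : ∀ {T v A k} → AllocationTree T v A k → EnvyFree Neighbour v A
  allocationTree-envyFree {v = v} {A} (run {Ps} _ _ division equal alg) = λ where
      (fwd i→j) → proj₁ (content i→j)
      (bwd j→i) → proj₂ (content j→i)
    where
    content : ∀ {i j} → i ParentOf j → V (v i) (A j) ≤ V (v i) (A i) × V (v j) (A i) ≤ V (v j) (A j)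
    content = algTree-envyFree alg (isPiece (Division⇒Refines {Xs = Ps} division) ([] ∷ []))
      (allPairs⇒indifferent (v root) equal)

  -- The initial `n - 1` cuts and the later ones are each at most `n²`, whence the constant 2.
  allocationTree-cuts : ∀ {T v A k} → AllocationTree T v A k → k ℕ.≤ 2 ℕ.* size T ℕ.^ 2
  allocationTree-cuts {T} (run {k = k} {l} _ 1+k≡n _ _ alg) = begin
    k ℕ.+ l        ≤⟨ ℕ.+-mono-≤ k≤n*n (algTree-cuts alg) ⟩
    n ℕ.* n ℕ.+ n ℕ.* n ≡⟨ Nat.solve 1 (λ n → n Nat.:* n Nat.:+ n Nat.:* n Nat.:= Nat.con 2 Nat.:* (n Nat.:^ 2)) ≡.refl n ⟩
    2 ℕ.* n ℕ.^ 2  ∎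
    where
    open ℕ.≤-Reasoning
    n = size T
    k≤n*n : k ℕ.≤ n ℕ.* n
    k≤n*n = ℕ.≤-trans (ℕ.n≤1+n k) (ℕ.≤-trans (ℕ.≤-reflexive 1+k≡n)
      (ℕ.m≤m*n n n ⦃ ℕ.>-nonZero (0<size T) ⦄))

-- Existence of a run

module Existence (ℝ : Reals) where

  open Reals ℝ hiding (zero)
  open OrderedField ℝ
  open CakeCutting ℝ
  open EqualDivision ℝ
  open Pieces ℝ
  open Run ℝ

  -- Sort the pieces by decreasing value and take the first `n`: sortedness relates every piece
  -- taken to every piece dropped.
  best : ∀ (f : Region → Carrier) n Ps → n ℕ.≤ length Ps → ∃[ chosen ] ∃[ rest ]
    length chosen ≡ n × Ps ↭ chosen ++ rest × All (λ P → All (λ Q → f Q ≤ f P) rest) chosen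
  best f n Ps n≤length =
    take n Qs , drop n Qs ,
    ≡.trans (length-take n Qs)
      (ℕ.m≤n⇒m⊓n≡m (≡.subst (n ℕ.≤_) (≡.sym (↭-length (sort-↭ Ps))) n≤length)) ,
    ↭-trans (↭-sym (sort-↭ Ps)) (↭-reflexive (≡.sym (take++drop≡id n Qs))) ,
    proj₂ (proj₂ (AllPairs-++⁻ (take n Qs)
      (≡.subst (AllPairs (λ P Q → f Q ≤ f P)) (≡.sym (take++drop≡id n Qs))
        (Linked⇒AllPairs (λ Q≤P R≤Q → ≤.trans R≤Q Q≤P) (sort-↗ Ps)))))
    where
    open Data.List.Sort (On.decTotalOrder ≥-decTotalOrder f) using (sort; sort-↭; sort-↗)
    Qs = sort Ps

  module _ {d} {ts : Fin d → Tree} (v : Vertex (node ts) → Density) where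

    pick-≡ : ∀ {chosen last c top order Ps rest} → chosen c ≡ top →
             length top ≡ size (ts c) → Ps ↭ top ++ rest →
             All (λ P → All (λ Q → V (v (below c root)) Q ≤ V (v (below c root)) P) rest) top →
             Choosing v chosen last order rest → Choosing v chosen last (c ∷ order) Ps
    pick-≡ ≡.refl = pick

    -- `Choosing` mentions the whole family `chosen`, while the recursion knows the picks only along
    -- `g`. The result is therefore stated for every family agreeing with those picks, and the
    -- family is fixed at the end with `g = id`.
    choose : ∀ m (g : Fin m → Fin d) Ps → length Ps ≡ suc (sum (tabulate (size ∘ ts ∘ g))) →
      ∃[ last ] Σ[ top ∈ (Fin m → List Region) ]
        ∀ chosen → (∀ k → chosen (g k) ≡ top k) → Choosing v chosen last (tabulate g) Ps
    choose zero    g (P ∷ []) _ = P , (λ ()) , λ _ _ → done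
    choose (suc m) g Ps number
      with best (V (v (below (g zero) root))) (size (ts (g zero))) Ps
                (≡.subst (size (ts (g zero)) ℕ.≤_) (≡.sym number)
                  (ℕ.m≤n⇒m≤1+n (ℕ.m≤m+n _ _)))
    ... | top₀ , rest , number₀ , Ps↭ , best₀
      with choose m (g ∘ suc) rest number-rest
      where
      -- The pieces outnumber the remaining subtrees' vertices by one throughout; the surplus piece
      -- goes to the root.
      number-rest : length rest ≡ suc (sum (tabulate (size ∘ ts ∘ g ∘ suc)))
      number-rest = ℕ.+-cancelˡ-≡ (size (ts (g zero))) _ _ (begin
        size (ts (g zero)) ℕ.+ length rest  ≡⟨ ≡.cong (ℕ._+ length rest) number₀ ⟨
        length top₀ ℕ.+ length rest         ≡⟨ length-++ top₀ ⟨
        length (top₀ ++ rest)               ≡⟨ ↭-length Ps↭ ⟨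
        length Ps                           ≡⟨ number ⟩
        suc (size (ts (g zero)) ℕ.+ sum (tabulate (size ∘ ts ∘ g ∘ suc))) ≡⟨ ℕ.+-suc _ _ ⟨
        size (ts (g zero)) ℕ.+ suc (sum (tabulate (size ∘ ts ∘ g ∘ suc))) ∎)
        where open ≡.≡-Reasoning
    ... | last , tops , choosing =
      last , (λ { zero → top₀ ; (suc k) → tops k }) , λ chosen chosen≡ →
        pick-≡ (chosen≡ zero) number₀ Ps↭ best₀ (choosing chosen (chosen≡ ∘ suc))

    allocate : Region → (∀ c → Vertex (ts c) → Region) → Vertex (node ts) → Region
    allocate last As root        = last
    allocate last As (below c i) = As c i

  -- Two invariants drive the recursion: the number of pieces, which lets the children pick, and
  -- their disjointness, which makes `S c` a piece to which Austin's procedure applies. Austin's cut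
  -- restores both for the subtree.
  algTree-exists : ∀ T (v : Vertex T → Density) → AustinAvailable v →
    ∀ Ps → length Ps ≡ size T → IsPiece (concat Ps) → ∃[ A ] ∃[ k ] AlgTree T v Ps A k
  algTree-exists (node {d} ts) v austin Ps number Ps-piece =
    allocate v last (λ c → proj₁ (recur c)) , _ ,
    run (allFin d) ↭-refl chosen choosing Xs (λ c → proj₁ (proj₂ (austinCut c))) (λ c → proj₁ (proj₂ (recur c)))
      (λ c → proj₂ (proj₂ (austinCut c))) (λ c → proj₂ (proj₂ (recur c)))
    where
    chosen-exists = choose v d id Ps number
    last = proj₁ chosen-exists
    chosen = proj₁ (proj₂ chosen-exists)
    choosing : Choosing v chosen last (allFin d) Ps
    choosing = proj₂ (proj₂ chosen-exists) chosen λ _ → ≡.refl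
    S-piece : ∀ c → IsPiece (concat (chosen c))
    S-piece c = Separates.piece (choosing-separates choosing Ps-piece) (∈-allFin c)
    austinCut : ∀ c → ∃[ Xs ] ∃[ k ] AustinCut (v (below c root)) (v root) (size (ts c)) (concat (chosen c)) Xs k
    austinCut c = austin (below c root) root (size (ts c)) (concat (chosen c)) (0<size (ts c)) (S-piece c)
    Xs : Fin d → List Region
    Xs c = proj₁ (austinCut c)
    recur : ∀ c → ∃[ A ] ∃[ k ] AlgTree (ts c) (v ∘ below c) (Xs c) A k
    recur c = let cut = proj₂ (proj₂ (austinCut c)) in
      algTree-exists (ts c) (v ∘ below c) (λ i j → austin (below c i) (below c j)) (Xs c)
        (AustinCut.number cut) (isPiece (austin-refines (Xs c) cut) (S-piece c))

  allocationTree-exists : ∀ T (v : Vertex T → Density) → AustinAvailable v →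
    ∃[ A ] ∃[ k ] AllocationTree T v A k
  allocationTree-exists T@(node ts) v austin =
    let
      -- The sizes of the children's subtrees add up to `size T - 1`, the number of initial cuts.
      Ps , number , division , equal = equalDivision (v root) (sum (tabulate (size ∘ ts)))
      A , l , alg = algTree-exists T v austin Ps number
        (isPiece (Division⇒Refines {Xs = Ps} division) ([] ∷ []))
    in A , _ , run number ≡.refl division equal alg

open import Data.Nat using (_*_; _^_; _≤_)

theorem2 : ∃[ C ] ((ℝ : Reals) (T : Tree) → let open CakeCutting ℝ in
    (v : Vertex T → Density) →
    (AustinAvailable v → ∃[ A ] ∃[ k ] AllocationTree T v A k) ×
    (∀ A k → AllocationTree T v A k →
    IsAllocation A × EnvyFree Neighbour v A × k ≤ C * size T ^ 2))
theorem2 = 2 , λ ℝ T v →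
  Existence.allocationTree-exists ℝ T v , λ A k alg →
  Run.allocationTree-isAllocation ℝ alg , Run.allocationTree-envyFree ℝ alg , Run.allocationTree-cuts ℝ alg
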